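{- Let $G=(V,E)$ be a finite connected graph (parallel edges allowed, no loops), with each edge $e$ given an orientation with endpoints $e^+$ and $e^-$. Fix any vertex $q\in V$. Then \[ \frac{\kappa_2(G)}{\kappa(G)} \;=\; \frac{3}{4}\sum_{e\in E}\bigl(r(e^+,q)-r(e^-,q)\bigr)^2 \;+\; \frac14\sum_{e\in E} r(e^+,e^-)^2, \] where $\kappa(G)$ is the number of spanning trees of $G$, $\kappa_2(G)$ is the number of spanning forests of $G$ with exactly two components, and $r(x,y)$ is the effective resistance between $x$ and $y$.
   Context: The effective resistance $r(x,y)$ is computed by viewing $G$ as an electrical network with a unit resistor on each edge; equivalently $r(x,y)=(\mathbf e_x-\mathbf e_y)^{\intercal}L^{+}(\mathbf e_x-\mathbf e_y)$ where $L$ is the Laplacian matrix of $G$ ($L_{v,v}=\deg v$, $L_{v,w}=-$(number of edges between $v$ and $w$) for $v\neq w$) and $L^+$ its Moore–Penrose pseudoinverse; equivalently $r(x,y)=\kappa_2(x|y)/\kappa(G)$, where $\kappa_2(x|y)$ is the number of two-component spanning forests with $x$ and $y$ in different components. -}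

module Defs where

open import Data.Nat using (ℕ; zero; suc; _≡ᵇ_; _<ᵇ_)
open import Data.Integer using (+_)
open import Data.Rational using (ℚ; 0ℚ; _/_; _+_; _*_; _-_)
open import Data.Bool using (Bool; true; false; not; _∧_; _∨_; if_then_else_)
open import Data.Fin using (Fin; toℕ; _≟_)
open import Data.Vec using (Vec; []; _∷_; lookup; _[_]≔_; replicate)
open import Data.List using (List; []; _∷_; _++_; map; filterᵇ; length; foldr; allFin)
open import Data.Bool.ListAction using (all; any)
open import Relation.Nullary.Decidable using (⌊_⌋)
open import Relation.Binary.PropositionalEquality using (_≡_; _≢_)

-- A finite multigraph without loops on vertex set Fin n with m edges.
-- Edge e is oriented from e⁺ = src e to e⁻ = tgt e.
record Graph : Set where
  field
    n      : ℕ
    m      : ℕ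
    src    : Fin m → Fin n
    tgt    : Fin m → Fin n
    noLoop : ∀ e → src e ≢ tgt e

module _ (G : Graph) where
  open Graph G

  EdgeSet : Set
  EdgeSet = Vec Bool m

  allEdges : EdgeSet
  allEdges = replicate m true

  step : EdgeSet → (Fin n → Bool) → (Fin n → Bool)
  step F R v = R v ∨ any (λ e → lookup F e ∧
                  ((⌊ src e ≟ v ⌋ ∧ R (tgt e)) ∨ (⌊ tgt e ≟ v ⌋ ∧ R (src e))))
                  (allFin m)


  iterate : EdgeSet → ℕ → (Fin n → Bool) → (Fin n → Bool)
  iterate F zero R = R
  iterate F (suc k) R = iterate F k (step F R)

  -- y is reachable from x in the spanning subgraph (V, F)
  -- (n rounds of closure suffice since a shortest path has < n edges)
  reach : EdgeSet → Fin n → Fin n → Bool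
  reach F x y = iterate F n (λ v → ⌊ v ≟ x ⌋) y

  Connected : Set
  Connected = ∀ x y → reach allEdges x y ≡ true

  -- F is acyclic: no edge of F lies on a cycle of F, i.e. removing any edge
  -- of F disconnects its endpoints.
  isForest : EdgeSet → Bool
  isForest F = all (λ e → not (lookup F e) ∨
                      not (reach (F [ e ]≔ false) (src e) (tgt e))) (allFin m)

  -- number of connected components of (V, F): count vertices that are the
  -- least vertex (in the order of Fin n) of their component
  numComponents : EdgeSet → ℕ
  numComponents F = length (filterᵇ (λ v → all (λ w → not (toℕ w <ᵇ toℕ v) ∨ not (reach F w v))
                                               (allFin n)) (allFin n))

  allSubsets : (k : ℕ) → List (Vec Bool k)
  allSubsets zero = [] ∷ []
  allSubsets (suc k) = map (false ∷_) (allSubsets k) ++ map (true ∷_) (allSubsets k)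

  forestCount : ℕ → ℕ
  forestCount c = length (filterᵇ (λ F → isForest F ∧ (numComponents F ≡ᵇ c)) (allSubsets m))

  κ : ℕ
  κ = forestCount 1

  κ₂ : ℕ
  κ₂ = forestCount 2

  κ₂sep : Fin n → Fin n → ℕ
  κ₂sep x y = length (filterᵇ (λ F → isForest F ∧ (numComponents F ≡ᵇ 2) ∧ not (reach F x y))
                              (allSubsets m))

-- a / b as a rational (b = 0 is never used under connectivity; returns 0 then)
divℚ : ℕ → ℕ → ℚ
divℚ a zero = 0ℚ
divℚ a (suc b) = (+ a) / suc b

module _ (G : Graph) where
  open Graph G

  r : Fin n → Fin n → ℚ
  r x y = divℚ (κ₂sep G x y) (κ G)

  sumEdges : (Fin m → ℚ) → ℚ
  sumEdges f = foldr (λ e acc → f e + acc) 0ℚ (allFin m)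

{-# OPTIONS --safe #-}
-- For x, y let g(x,y) be the number of two-component spanning forests in which x and y are
-- connected to each other but not to q; g/κ is the Green function of the Laplacian grounded at q.
-- In its weak form Σ_f du(f) dg(x,·)(f) = κ (u(x) - u(q)), this follows by adding f to a
-- two-component forest that f joins up: the left side becomes a sum over spanning trees of the
-- increments of u along the tree path from x to q.
--
-- For an edge e = xy put A = g(x,x), B = g(y,y), C = g(x,y).
-- * The component avoiding q is a tree, so κ₂ = Σ_v g(v,v) - Σ_e N_e, where N_e counts the
--   two-component forests that contain e and do not connect it to q.
-- * Taking u = δ_v in the weak form gives κ Σ_v g(v,v) = Σ_e (A(A - C) + B(B - C)).
-- * Pairing the Green functions of G and G - e with each other gives κ N_e = AB - C².
-- Hence κ κ₂ = Σ_e (A² + B² + C² - AB - AC - BC).  Finally κ r(x,q) = A, κ r(y,q) = B,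
-- κ r(x,y) = A + B - 2C, and 3(A - B)² + (A + B - 2C)² is four times the summand.
module Submission where

open import Defs
open import Data.Bool using (Bool; true; false; not; T; _∧_; _∨_)
open import Data.Bool.ListAction using (all; any)
open import Data.Bool.Properties using (T?; T-≡; T-∧; T-∨; ∧-assoc)
open import Data.Fin as Fin using (Fin; zero; suc; toℕ; _≟_)
open import Data.Fin.Induction using (<-wellFounded)
open import Data.Fin.Properties using (toℕ-injective; any?; all?; ¬∀⟶∃¬)
open import Data.Fin.Subset using (∣_∣; inside)
open import Data.Fin.Subset.Properties using (∣p∣≤n; ∣p∣≡n⇒p≡⊤; p⊂q⇒∣p∣<∣q∣)
open import Data.List using (List; []; _∷_; _++_; map; foldr; allFin; filterᵇ; length)
open import Data.List.Membership.Propositional using (_∈_; lose; find)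
open import Data.List.Membership.Propositional.Properties using (∈-allFin; ∈-filter⁺; ∈-filter⁻)
open import Data.List.Properties using (map-tabulate)
open import Data.List.Relation.Unary.All as All using (_∷_)
open import Data.List.Relation.Unary.All.Properties using (all⁺; all⁻)
open import Data.List.Relation.Unary.AllPairs using (_∷_)
open import Data.List.Relation.Unary.Any using (here; there)
open import Data.List.Relation.Unary.Any.Properties using (any⁺; any⁻)
open import Data.List.Relation.Unary.Unique.Propositional using (Unique)
open import Data.List.Relation.Unary.Unique.Propositional.Properties using (allFin⁺; filter⁺)
open import Data.Nat as ℕ using (ℕ; zero; suc; _≤_; _<_; _<ᵇ_; _≡ᵇ_)
import Data.Nat.Properties as ℕ
open import Data.Product using (∃; _×_; _,_; proj₁; proj₂)
open import Data.Sum using (_⊎_; inj₁; inj₂; [_,_]′) renaming (map to map-⊎)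
open import Data.Vec as Vec using (Vec; _∷_; lookup; tabulate; _[_]≔_)
open import Data.Vec.Properties using (lookup∘tabulate; lookup∘update; lookup∘update′; lookup-replicate; []=⇒lookup; lookup⇒[]=; []≔-idempotent; []≔-lookup; []≔-commutes)
open import Function using (_∘_; id; _⇔_; mk⇔; Equivalence)
open import Induction.WellFounded using (Acc; acc)
open import Relation.Binary.Construct.Closure.Equivalence as Eq using (EqClosure)
open import Relation.Binary.Construct.Closure.ReflexiveTransitive using (ε; _◅_; _◅◅_)
open import Relation.Binary.Construct.Closure.Symmetric using (SymClosure; fwd; bwd)
open import Relation.Binary.PropositionalEquality using (_≡_; _≢_; refl; sym; trans; cong; cong₂; subst; module ≡-Reasoning)
open import Relation.Nullary using (¬_; yes; no; contradiction)
open import Relation.Nullary.Decidable using (⌊_⌋; toWitness; fromWitness; _×-dec_; _→-dec_; decidable-stable)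

open Equivalence using (to; from)
open ≡-Reasoning

-- Reflection of Boolean tests over finite index sets

T-not : ∀ {b} → T (not b) ⇔ (¬ T b)
T-not {true}  = mk⇔ (λ ()) (λ ¬t → ¬t _)
T-not {false} = mk⇔ (λ _ ()) (λ _ → _)

T-all : ∀ {k} (p : Fin k → Bool) → T (all p (allFin k)) ⇔ (∀ i → T (p i))
T-all p = mk⇔ (λ t i → All.lookup (all⁺ p (allFin _) t) (∈-allFin i))
              (λ h → all⁻ p {xs = allFin _} (All.tabulate λ {i} _ → h i))

T-any : ∀ {k} (p : Fin k → Bool) → T (any p (allFin k)) ⇔ (∃ λ i → T (p i))
T-any p = mk⇔ (λ t → let (i , _ , pi) = find (any⁻ p (allFin _) t) in i , pi)
              (λ (i , pi) → any⁺ p (lose (∈-allFin i) pi))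

-- Counting equivalence classes by their least elements

module LeastRepresentatives {n : ℕ} (E : Fin n → Fin n → Bool)
  (E-refl  : ∀ {x} → T (E x x))
  (E-sym   : ∀ {x y} → T (E x y) → T (E y x))
  (E-trans : ∀ {x y z} → T (E x y) → T (E y z) → T (E x z))
  where

  -- Spelled exactly like the test in `numComponents`, so that for `E = reach G F` the length of
  -- `least` is `numComponents G F` by definition.
  isLeast : Fin n → Bool
  isLeast v = all (λ w → not (toℕ w <ᵇ toℕ v) ∨ not (E w v)) (allFin n)

  least : List (Fin n)
  least = filterᵇ isLeast (allFin n)

  T-isLeast : ∀ {v} → T (isLeast v) ⇔ (∀ w → toℕ w < toℕ v → ¬ T (E w v))
  T-isLeast {v} = mk⇔
    (λ t w w<v → [ (λ w≮v → contradiction (ℕ.<⇒<ᵇ w<v) (to T-not w≮v)) , to T-not ]′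
                   (to T-∨ (to (T-all _) t w)))
    (λ h → from (T-all _) λ w → from T-∨ (dichotomy w h))
    where
    dichotomy : ∀ w → (∀ w → toℕ w < toℕ v → ¬ T (E w v)) →
                T (not (toℕ w <ᵇ toℕ v)) ⊎ T (not (E w v))
    dichotomy w h with T? (toℕ w <ᵇ toℕ v)
    ... | yes w<v = inj₂ (from T-not (h w (ℕ.<ᵇ⇒< _ _ w<v)))
    ... | no  w≮v = inj₁ (from T-not w≮v)

  ∈-least : ∀ {v} → T (isLeast v) → v ∈ least
  ∈-least {v} t = ∈-filter⁺ (T? ∘ isLeast) (∈-allFin v) t

  least-isLeast : ∀ {v} → v ∈ least → T (isLeast v)
  least-isLeast v∈ = proj₂ (∈-filter⁻ (T? ∘ isLeast) {xs = allFin n} v∈)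

  least-unique : Unique least
  least-unique = filter⁺ (T? ∘ isLeast) (allFin⁺ n)

  E-least⇒≡ : ∀ {v w} → v ∈ least → w ∈ least → T (E v w) → v ≡ w
  E-least⇒≡ {v} {w} v∈ w∈ vw = toℕ-injective (ℕ.≤-antisym
    (ℕ.≮⇒≥ λ w<v → to T-isLeast (least-isLeast v∈) w w<v (E-sym vw))
    (ℕ.≮⇒≥ λ v<w → to T-isLeast (least-isLeast w∈) v v<w vw))

  -- Well-founded descent: while some smaller vertex is equivalent, pass to it; when none is left,
  -- the vertex is least in its class.
  representative : ∀ v → ∃ λ w → w ∈ least × T (E w v)
  representative v = go v (<-wellFounded v)
    where
    go : ∀ v → Acc Fin._<_ v → ∃ λ w → w ∈ least × T (E w v)
    go v (acc rs) with any? (λ w → (toℕ w ℕ.<? toℕ v) ×-dec T? (E w v))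
    ... | yes (w , w<v , wv) = let (u , u∈ , uw) = go w (rs w<v) in u , u∈ , E-trans uw wv
    ... | no  ¬∃ = v , ∈-least (from T-isLeast λ w w<v wv → ¬∃ (w , w<v , wv)) , E-refl

  -- The root q only guarantees that the vertex set is nonempty.
  length≡1 : Fin n → length least ≡ 1 ⇔ (∀ v w → T (E v w))
  length≡1 q = mk⇔ (λ l v w → one least refl l v w) (connected least refl)
    where
    one : ∀ l → l ≡ least → length least ≡ 1 → ∀ v w → T (E v w)
    one (a ∷ []) l≡ _ v w = E-trans (E-sym (toA v)) (toA w)
      where
      toA : ∀ v → T (E a v)
      toA v with representative v
      ... | u , u∈ , uv with subst (u ∈_) (sym l≡) u∈
      ...   | here refl = uv
    one []          l≡ len with () ← trans (cong length l≡) len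
    one (_ ∷ _ ∷ _) l≡ len with () ← trans (cong length l≡) len

    connected : ∀ l → l ≡ least → (∀ v w → T (E v w)) → length least ≡ 1
    connected [] l≡ h with representative q
    ... | u , u∈ , _ with () ← subst (u ∈_) (sym l≡) u∈
    connected (a ∷ []) l≡ h = cong length (sym l≡)
    connected (a ∷ b ∷ l) l≡ h with subst Unique (sym l≡) least-unique
    ... | (a≢b ∷ _) ∷ _ = contradiction
      (E-least⇒≡ (subst (a ∈_) l≡ (here refl)) (subst (b ∈_) l≡ (there (here refl))) (h a b)) a≢b

  -- Two classes as seen from `q`: something lies outside the class of `q`, and whatever lies
  -- outside is a single class. All later case distinctions ask only whether a vertex is on the side
  -- of `q`.
  TwoClasses : Fin n → Set
  TwoClasses q = (∃ λ b → ¬ T (E b q)) × (∀ v w → ¬ T (E v q) → ¬ T (E w q) → T (E v w))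

  length≡2 : ∀ q → length least ≡ 2 ⇔ TwoClasses q
  length≡2 q = mk⇔ (two least refl) (λ (b , j) → separated least refl b j)
    where
    qʳ = proj₁ (representative q)
    qʳ∈ = proj₁ (proj₂ (representative q))
    qʳ∼q = proj₂ (proj₂ (representative q))

    two′ : ∀ {a b} → a ∈ least → b ∈ least → a ≢ b → T (E a q) →
           (∀ v → T (E a v) ⊎ T (E b v)) → TwoClasses q
    two′ {a} {b} a∈ b∈ a≢b aq cover =
      (b , λ bq → a≢b (E-least⇒≡ a∈ b∈ (E-trans aq (E-sym bq)))) ,
      λ v w v≁q w≁q → E-trans (E-sym (toB v v≁q)) (toB w w≁q)
      where
      toB : ∀ v → ¬ T (E v q) → T (E b v)
      toB v v≁q = [ (λ av → contradiction (E-trans (E-sym av) aq) v≁q) , (λ bv → bv) ]′ (cover v)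

    two : ∀ l → l ≡ least → length least ≡ 2 → TwoClasses q
    two (a ∷ b ∷ []) l≡ _ with subst Unique (sym l≡) least-unique
    -- Whichever representative is equivalent to `q`, the other one witnesses the second class.
    ... | (a≢b ∷ _) ∷ _ = [ (λ aq → two′ a∈ b∈ a≢b aq cover)
                          , (λ bq → two′ b∈ a∈ (a≢b ∘ sym) bq ([ inj₂ , inj₁ ]′ ∘ cover)) ]′ (cover q)
      where
      a∈ = subst (a ∈_) l≡ (here refl)
      b∈ = subst (b ∈_) l≡ (there (here refl))
      cover : ∀ v → T (E a v) ⊎ T (E b v)
      cover v with representative v
      ... | u , u∈ , uv with subst (u ∈_) (sym l≡) u∈
      ...   | here refl = inj₁ uv
      ...   | there (here refl) = inj₂ uv
    two []              l≡ len with () ← trans (cong length l≡) len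
    two (_ ∷ [])        l≡ len with () ← trans (cong length l≡) len
    two (_ ∷ _ ∷ _ ∷ _) l≡ len with () ← trans (cong length l≡) len

    separated : ∀ l → l ≡ least → (∃ λ b → ¬ T (E b q)) →
                (∀ v w → ¬ T (E v q) → ¬ T (E w q) → T (E v w)) → length least ≡ 2
    separated [] l≡ _ _ with () ← subst (qʳ ∈_) (sym l≡) qʳ∈
    separated (a ∷ []) l≡ (b , b≁q) _ with representative b
    ... | u , u∈ , ub with subst (u ∈_) (sym l≡) u∈ | subst (qʳ ∈_) (sym l≡) qʳ∈
    ...   | here refl | here qʳ≡u = contradiction (E-trans (E-sym ub) (subst (λ z → T (E z q)) qʳ≡u qʳ∼q)) b≁q
    separated (a ∷ b ∷ []) l≡ _ _ = cong length (sym l≡)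
    separated (a ∷ b ∷ c ∷ l) l≡ _ join with subst Unique (sym l≡) least-unique
    ... | (a≢b ∷ a≢c ∷ _) ∷ (b≢c ∷ _) ∷ _ = pigeon (T? (E a q)) (T? (E b q)) (T? (E c q))
      where
      a∈ = subst (a ∈_) l≡ (here refl)
      b∈ = subst (b ∈_) l≡ (there (here refl))
      c∈ = subst (c ∈_) l≡ (there (there (here refl)))
      -- Of three representatives, two are both equivalent to `q` or both not. Either way they are
      -- equivalent to each other, against uniqueness.
      pigeon : _ → _ → _ → length least ≡ 2
      pigeon (yes aq) (yes bq) _ = contradiction (E-least⇒≡ a∈ b∈ (E-trans aq (E-sym bq))) a≢b
      pigeon (yes aq) _ (yes cq) = contradiction (E-least⇒≡ a∈ c∈ (E-trans aq (E-sym cq))) a≢c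
      pigeon _ (yes bq) (yes cq) = contradiction (E-least⇒≡ b∈ c∈ (E-trans bq (E-sym cq))) b≢c
      pigeon (no a≁) (no b≁) _ = contradiction (E-least⇒≡ a∈ b∈ (join a b a≁ b≁)) a≢b
      pigeon (no a≁) _ (no c≁) = contradiction (E-least⇒≡ a∈ c∈ (join a c a≁ c≁)) a≢c
      pigeon _ (no b≁) (no c≁) = contradiction (E-least⇒≡ b∈ c∈ (join b c b≁ c≁)) b≢c

-- Connectivity in spanning subgraphs

module Forests (G : Graph) where
  open Graph G

  -- Only the given orientation is recorded; the equivalence closure supplies reversed edges and
  -- walks.
  data Adj (F : EdgeSet G) : Fin n → Fin n → Set where
    joins : ∀ e → T (lookup F e) → Adj F (src e) (tgt e)

  _⊢_∼_ : EdgeSet G → Fin n → Fin n → Set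
  F ⊢ a ∼ b = EqClosure (Adj F) a b

  ∼-sym : ∀ {F a b} → F ⊢ a ∼ b → F ⊢ b ∼ a
  ∼-sym {F} = Eq.symmetric (Adj F)

  edge : ∀ {F e} → T (lookup F e) → F ⊢ src e ∼ tgt e
  edge e∈F = Eq.return (joins _ e∈F)

  step-complete : ∀ F R {v w} → SymClosure (Adj F) v w → T (R v) → T (step G F R w)
  step-complete F R {v} {w} vw Rv = from T-∨ (inj₂ (from (T-any _) (witness vw)))
    where
    witness : SymClosure (Adj F) v w → ∃ λ e → T (lookup F e ∧
                ((⌊ src e ≟ w ⌋ ∧ R (tgt e)) ∨ (⌊ tgt e ≟ w ⌋ ∧ R (src e))))
    witness (fwd (joins e e∈F)) =
      e , from T-∧ (e∈F , from (T-∨ {⌊ src e ≟ w ⌋ ∧ R (tgt e)}) (inj₂ (from T-∧ (fromWitness refl , Rv))))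
    witness (bwd (joins e e∈F)) =
      e , from T-∧ (e∈F , from (T-∨ {⌊ src e ≟ w ⌋ ∧ R (tgt e)}) (inj₁ (from T-∧ (fromWitness refl , Rv))))

  step-sound : ∀ F R {w} → T (step G F R w) → T (R w) ⊎ (∃ λ v → SymClosure (Adj F) v w × T (R v))
  step-sound F R {w} t = map-⊎ (λ Rw → Rw) neighbour (to T-∨ t)
    where
    neighbour : T (any _ (allFin m)) → ∃ λ v → SymClosure (Adj F) v w × T (R v)
    neighbour t with to (T-any _) t
    ... | e , te with to (T-∧ {lookup F e}) te
    ...   | e∈F , ends with to (T-∨ {⌊ src e ≟ w ⌋ ∧ R (tgt e)}) ends
    ...     | inj₁ s = let (src≡w , Rt) = to (T-∧ {⌊ src e ≟ w ⌋}) s in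
                       tgt e , subst (SymClosure (Adj F) (tgt e)) (toWitness src≡w) (bwd (joins e e∈F)) , Rt
    ...     | inj₂ s = let (tgt≡w , Rs) = to (T-∧ {⌊ tgt e ≟ w ⌋}) s in
                       src e , subst (SymClosure (Adj F) (src e)) (toWitness tgt≡w) (fwd (joins e e∈F)) , Rs

  iterate-sound : ∀ F x k R → (∀ {v} → T (R v) → F ⊢ x ∼ v) →
                  ∀ {v} → T (iterate G F k R v) → F ⊢ x ∼ v
  iterate-sound F x zero    R h t = h t
  iterate-sound F x (suc k) R h t = iterate-sound F x k (step G F R)
    (λ s → [ h , (λ (_ , vw , Rv) → h Rv ◅◅ (vw ◅ ε)) ]′ (step-sound F R s)) t

  iterate-inflationary : ∀ F k R {v} → T (R v) → T (iterate G F k R v)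
  iterate-inflationary F zero    R t = t
  iterate-inflationary F (suc k) R t = iterate-inflationary F k (step G F R) (from T-∨ (inj₁ t))

  Closed : EdgeSet G → (Fin n → Bool) → Set
  Closed F R = ∀ v → T (step G F R v) → T (R v)

  step-mono : ∀ F {R R′} → (∀ v → T (R v) → T (R′ v)) → ∀ v → T (step G F R v) → T (step G F R′ v)
  step-mono F {R} {R′} R⊆R′ v t with step-sound F R t
  ... | inj₁ Rv              = from T-∨ (inj₁ (R⊆R′ v Rv))
  ... | inj₂ (w , w→v , Rw) = step-complete F R′ w→v (R⊆R′ w Rw)

  Closed-iterate : ∀ F k {R} → Closed F R → Closed F (iterate G F k R)
  Closed-iterate F zero    c = c
  Closed-iterate F (suc k) c = Closed-iterate F k (step-mono F c)

  -- Each round that does not close R up adds a vertex, so n rounds suffice.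
  iterate-closed : ∀ F k R → n ≤ k ℕ.+ ∣ tabulate R ∣ → Closed F (iterate G F k R)
  -- With no rounds left the bound forces `R` to contain all `n` vertices, so it is closed
  -- trivially.
  iterate-closed F zero R n≤∣R∣ v _ = from T-≡ (trans (sym (lookup∘tabulate R v))
    (trans (cong (λ p → lookup p v) (∣p∣≡n⇒p≡⊤ {p = tabulate R} (ℕ.≤-antisym (∣p∣≤n (tabulate R)) n≤∣R∣)))
           (lookup-replicate v inside)))
  iterate-closed F (suc k) R n≤ with all? (λ v → T? (step G F R v) →-dec T? (R v))
  ... | yes c = Closed-iterate F (suc k) c
  ... | no ¬c with ¬∀⟶∃¬ n _ (λ v → T? (step G F R v) →-dec T? (R v)) ¬c
  ...   | v , ¬sv→Rv = iterate-closed F k (step G F R)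
            (ℕ.≤-trans n≤ (ℕ.≤-trans (ℕ.≤-reflexive (sym (ℕ.+-suc k _))) (ℕ.+-monoʳ-≤ k ∣R∣<∣sR∣)))
    where
    member : ∀ {R : Fin n → Bool} {w} → T (R w) → tabulate R Vec.[ w ]= inside
    member {R} {w} t = lookup⇒[]= w _ (trans (lookup∘tabulate R w) (to T-≡ t))
    member⁻ : ∀ {R : Fin n → Bool} {w} → tabulate R Vec.[ w ]= inside → T (R w)
    member⁻ {R} {w} p = from T-≡ (trans (sym (lookup∘tabulate R w)) ([]=⇒lookup p))
    ∣R∣<∣sR∣ : ∣ tabulate R ∣ < ∣ tabulate (step G F R) ∣
    ∣R∣<∣sR∣ = p⊂q⇒∣p∣<∣q∣
      ( (λ {w} p → member {step G F R} (from (T-∨ {R w}) (inj₁ (member⁻ {R} p))))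
      , v
      , member {step G F R} (decidable-stable (T? _) λ ¬s → ¬sv→Rv λ s → contradiction s ¬s)
      , λ p → ¬sv→Rv λ _ → member⁻ {R} p )

  -- Soundness holds round by round. For completeness, the set after `n` rounds contains `x` and is
  -- closed under adjacency, so it can be followed along any walk, however long.
  reach⇔∼ : ∀ {F x y} → T (reach G F x y) ⇔ F ⊢ x ∼ y
  reach⇔∼ {F} {x} {y} = mk⇔
    (iterate-sound F x n start λ t → subst (F ⊢ x ∼_) (sym (toWitness t)) ε)
    (λ xy → walk xy (iterate-inflationary F n start (fromWitness refl)))
    where
    start : Fin n → Bool
    start v = ⌊ v ≟ x ⌋
    walk : ∀ {v w} → F ⊢ v ∼ w → T (iterate G F n start v) → T (iterate G F n start w)
    walk ε        t = t
    walk (s ◅ ss) t = walk ss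
      (iterate-closed F n start (ℕ.m≤m+n n _) _ (step-complete F _ s t))

  reach-refl : ∀ {F x} → T (reach G F x x)
  reach-refl = from reach⇔∼ ε

  reach-sym : ∀ {F x y} → T (reach G F x y) → T (reach G F y x)
  reach-sym = from reach⇔∼ ∘ ∼-sym ∘ to reach⇔∼

  reach-trans : ∀ {F x y z} → T (reach G F x y) → T (reach G F y z) → T (reach G F x z)
  reach-trans xy yz = from reach⇔∼ (to reach⇔∼ xy ◅◅ to reach⇔∼ yz)

  module Representatives (F : EdgeSet G) =
    LeastRepresentatives (reach G F) reach-refl reach-sym reach-trans

  ∼-mono : ∀ {F F′} → (∀ e → T (lookup F e) → T (lookup F′ e)) → ∀ {a b} → F ⊢ a ∼ b → F′ ⊢ a ∼ b
  ∼-mono F⊆F′ = Eq.map λ { (joins e e∈F) → joins e (F⊆F′ e e∈F) }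

  ⊆-insert : ∀ (F : EdgeSet G) e f → T (lookup F f) → T (lookup (F [ e ]≔ true) f)
  ⊆-insert F e f f∈F with f ≟ e
  ... | yes refl = from T-≡ (lookup∘update e F true)
  ... | no  f≢e  = subst T (sym (lookup∘update′ f≢e F true)) f∈F

  delete-⊆ : ∀ (F : EdgeSet G) e f → T (lookup (F [ e ]≔ false) f) → T (lookup F f)
  delete-⊆ F e f f∈F with f ≟ e
  ... | yes refl with () ← subst T (lookup∘update e F false) f∈F
  ... | no  f≢e  = subst T (lookup∘update′ f≢e F false) f∈F

  ∈-delete : ∀ (F : EdgeSet G) {e f} → f ≢ e → T (lookup F f) → T (lookup (F [ e ]≔ false) f)
  ∈-delete F f≢e = subst T (sym (lookup∘update′ f≢e F false))

  delete-∉ : ∀ (F : EdgeSet G) e → ¬ T (lookup F e) → F [ e ]≔ false ≡ F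
  delete-∉ F e e∉F with lookup F e in eq
  ... | true  = contradiction _ e∉F
  ... | false = trans (cong (F [ e ]≔_) (sym eq)) ([]≔-lookup F e)

  insert-∈ : ∀ (F : EdgeSet G) e → T (lookup F e) → F [ e ]≔ true ≡ F
  insert-∈ F e e∈F = trans (cong (F [ e ]≔_) (sym (to T-≡ e∈F))) ([]≔-lookup F e)

  MeetsEdge : EdgeSet G → Fin m → Fin n → Set
  MeetsEdge F e a = F ⊢ a ∼ src e ⊎ F ⊢ a ∼ tgt e

  -- The right-hand side is an equivalence relation in `a` and `b` that contains every adjacency of
  -- F + e, hence it contains the closure.
  ∼-insert : ∀ F e {a b} → (F [ e ]≔ true) ⊢ a ∼ b → F ⊢ a ∼ b ⊎ (MeetsEdge F e a × MeetsEdge F e b)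
  ∼-insert F e = Eq.fold (record { refl = inj₁ ε ; sym = symm ; trans = transi }) single
    where
    S : Fin n → Fin n → Set
    S a b = F ⊢ a ∼ b ⊎ (MeetsEdge F e a × MeetsEdge F e b)
    symm : ∀ {a b} → S a b → S b a
    symm (inj₁ p)       = inj₁ (∼-sym p)
    symm (inj₂ (p , q)) = inj₂ (q , p)
    move : ∀ {a b} → F ⊢ a ∼ b → MeetsEdge F e b → MeetsEdge F e a
    move p = map-⊎ (p ◅◅_) (p ◅◅_)
    transi : ∀ {a b c} → S a b → S b c → S a c
    transi (inj₁ p)       (inj₁ q)       = inj₁ (p ◅◅ q)
    transi (inj₁ p)       (inj₂ (q , r)) = inj₂ (move p q , r)
    transi (inj₂ (p , q)) (inj₁ r)       = inj₂ (p , move (∼-sym r) q)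
    transi (inj₂ (p , _)) (inj₂ (_ , r)) = inj₂ (p , r)
    single : ∀ {a b} → Adj (F [ e ]≔ true) a b → S a b
    single (joins f f∈) with f ≟ e
    ... | yes refl = inj₂ (inj₁ ε , inj₂ ε)
    ... | no  f≢e  = inj₁ (edge (subst T (lookup∘update′ f≢e F true) f∈))

  -- Reinserting `e` into F - e gives back F, so this is `∼-insert` for F - e.
  ∼-delete : ∀ F e → T (lookup F e) → ∀ {a b} → F ⊢ a ∼ b →
             (F [ e ]≔ false) ⊢ a ∼ b ⊎ (MeetsEdge (F [ e ]≔ false) e a × MeetsEdge (F [ e ]≔ false) e b)
  ∼-delete F e e∈F {a} {b} ab = ∼-insert (F [ e ]≔ false) e
    (subst (_⊢ a ∼ b) (sym (trans ([]≔-idempotent F e) (insert-∈ F e e∈F))) ab)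

  -- Spanning trees and two-component forests

  Forest : EdgeSet G → Set
  Forest F = ∀ e → T (lookup F e) → ¬ ((F [ e ]≔ false) ⊢ src e ∼ tgt e)

  isForest⇔ : ∀ {F} → T (isForest G F) ⇔ Forest F
  isForest⇔ {F} = mk⇔
    (λ t e e∈F st → [ (λ e∉F → to T-not e∉F e∈F) , (λ ¬r → to T-not ¬r (from reach⇔∼ st)) ]′
                      (to T-∨ (to (T-all _) t e)))
    (λ h → from (T-all _) λ e → from T-∨ (dichotomy h e))
    where
    dichotomy : Forest F → ∀ e → T (not (lookup F e)) ⊎ T (not (reach G (F [ e ]≔ false) (src e) (tgt e)))
    dichotomy h e with T? (lookup F e)
    ... | yes e∈F = inj₂ (from T-not (h e e∈F ∘ to reach⇔∼))
    ... | no  e∉F = inj₁ (from T-not e∉F)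

  isTree isTwoForest : EdgeSet G → Bool
  isTree      F = isForest G F ∧ (numComponents G F ≡ᵇ 1)
  isTwoForest F = isForest G F ∧ (numComponents G F ≡ᵇ 2)

  Tree : EdgeSet G → Set
  Tree F = Forest F × (∀ v w → F ⊢ v ∼ w)

  TwoForest : Fin n → EdgeSet G → Set
  TwoForest q F = Forest F × (∃ λ b → ¬ F ⊢ b ∼ q) × (∀ v w → ¬ F ⊢ v ∼ q → ¬ F ⊢ w ∼ q → F ⊢ v ∼ w)

  isTree⇔ : Fin n → ∀ {F} → T (isTree F) ⇔ Tree F
  isTree⇔ q {F} = mk⇔
    (λ t → let (f , c) = to (T-∧ {isForest G F}) t in
      to isForest⇔ f , λ v w → to reach⇔∼ (to (length≡1 q) (ℕ.≡ᵇ⇒≡ _ 1 c) v w))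
    (λ (f , c) → from T-∧ (from isForest⇔ f ,
      ℕ.≡⇒≡ᵇ _ 1 (from (length≡1 q) λ v w → from reach⇔∼ (c v w))))
    where open Representatives F

  isTwoForest⇔ : ∀ q {F} → T (isTwoForest F) ⇔ TwoForest q F
  isTwoForest⇔ q {F} = mk⇔
    (λ t → let (f , c) = to (T-∧ {isForest G F}) t
               ((b , b≁q) , join) = to (length≡2 q) (ℕ.≡ᵇ⇒≡ _ 2 c) in
      to isForest⇔ f , (b , b≁q ∘ from reach⇔∼) ,
      λ v w v≁q w≁q → to reach⇔∼ (join v w (v≁q ∘ to reach⇔∼) (w≁q ∘ to reach⇔∼)))
    (λ (f , (b , b≁q) , join) → from T-∧ (from isForest⇔ f ,
      ℕ.≡⇒≡ᵇ _ 2 (from (length≡2 q) ((b , b≁q ∘ to reach⇔∼) ,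
      λ v w v≁q w≁q → from reach⇔∼ (join v w (v≁q ∘ from reach⇔∼) (w≁q ∘ from reach⇔∼))))))
    where open Representatives F

  ∼? : ∀ F a b → F ⊢ a ∼ b ⊎ ¬ F ⊢ a ∼ b
  ∼? F a b with T? (reach G F a b)
  ... | yes t = inj₁ (to reach⇔∼ t)
  ... | no ¬t = inj₂ (¬t ∘ from reach⇔∼)

  -- Deleting an edge from a tree leaves the components of its two ends, one of them containing `q`.
  -- Conversely, an edge with separated ends runs between the side of `q` and the only other
  -- component, so adding it connects everything and closes no cycle.
  Tree-insert⇔ : ∀ q F f → ¬ T (lookup F f) →
                 Tree (F [ f ]≔ true) ⇔ (TwoForest q F × ¬ F ⊢ src f ∼ tgt f)
  Tree-insert⇔ q F f f∉F = mk⇔ remove insert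
    where
    F⁺ = F [ f ]≔ true

    F⁺-f≡F : F⁺ [ f ]≔ false ≡ F
    F⁺-f≡F = trans ([]≔-idempotent F f) (delete-∉ F f f∉F)

    f∈F⁺ : T (lookup F⁺ f)
    f∈F⁺ = from T-≡ (lookup∘update f F true)

    e≢f : ∀ {e} → T (lookup F e) → e ≢ f
    e≢f e∈F refl = f∉F e∈F

    F-e⊆F⁺-e : ∀ e → T (lookup F e) → ∀ g → T (lookup (F [ e ]≔ false) g) → T (lookup (F⁺ [ e ]≔ false) g)
    F-e⊆F⁺-e e e∈F g t = subst (λ X → T (lookup X g)) ([]≔-commutes F e f (e≢f e∈F)) (⊆-insert (F [ e ]≔ false) f g t)

    remove : Tree F⁺ → TwoForest q F × ¬ F ⊢ src f ∼ tgt f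
    remove (forest , conn) =
      ( (λ e e∈F p → forest e (⊆-insert F f e e∈F) (∼-mono (F-e⊆F⁺-e e e∈F) p))
      , separated , join ) , s≁t
      where
      s≁t : ¬ F ⊢ src f ∼ tgt f
      s≁t p = forest f f∈F⁺ (subst (_⊢ src f ∼ tgt f) (sym F⁺-f≡F) p)
      meets : ∀ v → MeetsEdge F f v
      meets v = [ inj₁ , proj₁ ]′ (∼-insert F f (conn v (src f)))
      separated : ∃ λ b → ¬ F ⊢ b ∼ q
      separated = [ (λ qs → tgt f , λ tq → s≁t (∼-sym (tq ◅◅ qs)))
                  , (λ qt → src f , λ sq → s≁t (sq ◅◅ qt)) ]′ (meets q)
      -- Every vertex still reaches one end of `f`. If it does not reach `q`, it reaches the end
      -- that `q` does not.
      join : ∀ v w → ¬ F ⊢ v ∼ q → ¬ F ⊢ w ∼ q → F ⊢ v ∼ w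
      join v w v≁q w≁q with meets q | meets v | meets w
      ... | inj₁ qs | inj₁ vs | _       = contradiction (vs ◅◅ ∼-sym qs) v≁q
      ... | inj₁ qs | _       | inj₁ ws = contradiction (ws ◅◅ ∼-sym qs) w≁q
      ... | inj₁ qs | inj₂ vt | inj₂ wt = vt ◅◅ ∼-sym wt
      ... | inj₂ qt | inj₂ vt | _       = contradiction (vt ◅◅ ∼-sym qt) v≁q
      ... | inj₂ qt | _       | inj₂ wt = contradiction (wt ◅◅ ∼-sym qt) w≁q
      ... | inj₂ qt | inj₁ vs | inj₁ ws = vs ◅◅ ∼-sym ws

    insert : TwoForest q F × ¬ F ⊢ src f ∼ tgt f → Tree F⁺
    insert ((forest , _ , join) , s≁t) = forest⁺ , λ v w → toSrc v ◅◅ ∼-sym (toSrc w)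
      where
      forest⁺ : Forest F⁺
      forest⁺ e e∈F⁺ p with e ≟ f
      ... | yes refl = s≁t (subst (_⊢ src f ∼ tgt f) F⁺-f≡F p)
      ... | no  e≢f  = cycle (∼-insert (F [ e ]≔ false) f (subst (_⊢ src e ∼ tgt e) (sym ([]≔-commutes F e f e≢f)) p))
        where
        e∈F = subst T (lookup∘update′ e≢f F true) e∈F⁺
        up : ∀ {a b} → (F [ e ]≔ false) ⊢ a ∼ b → F ⊢ a ∼ b
        up = ∼-mono (delete-⊆ F e)
        -- A connection of the ends of `e` in F - e + f either exists in F - e already, against F
        -- being a forest, or attaches the two ends of `e` to opposite ends of `f`. In the latter
        -- case `e` itself connects the ends of `f` in F.
        cycle : ¬ ((F [ e ]≔ false) ⊢ src e ∼ tgt e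
                   ⊎ (MeetsEdge (F [ e ]≔ false) f (src e) × MeetsEdge (F [ e ]≔ false) f (tgt e)))
        cycle (inj₁ st) = forest e e∈F st
        cycle (inj₂ (inj₁ s , inj₁ t)) = forest e e∈F (s ◅◅ ∼-sym t)
        cycle (inj₂ (inj₂ s , inj₂ t)) = forest e e∈F (s ◅◅ ∼-sym t)
        cycle (inj₂ (inj₁ s , inj₂ t)) = s≁t (∼-sym (up s) ◅◅ edge e∈F ◅◅ up t)
        cycle (inj₂ (inj₂ s , inj₁ t)) = s≁t (∼-sym (up t) ◅◅ ∼-sym (edge e∈F) ◅◅ up s)

      lift : ∀ {a b} → F ⊢ a ∼ b → F⁺ ⊢ a ∼ b
      lift = ∼-mono (⊆-insert F f)

      -- Exactly one end of `f` is on the side of `q`. Each vertex reaches the end on its own side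
      -- and crosses `f` if that end is not `src f`.
      toSrc : ∀ v → F⁺ ⊢ v ∼ src f
      toSrc v with ∼? F v q | ∼? F (src f) q | ∼? F (tgt f) q
      ... | inj₁ vq | inj₁ sq | _       = lift (vq ◅◅ ∼-sym sq)
      ... | inj₁ vq | inj₂ _  | inj₁ tq = lift (vq ◅◅ ∼-sym tq) ◅◅ ∼-sym (edge f∈F⁺)
      ... | inj₂ vq | inj₂ sq | _       = lift (join _ _ vq sq)
      ... | inj₂ vq | inj₁ _  | inj₂ tq = lift (join _ _ vq tq) ◅◅ ∼-sym (edge f∈F⁺)
      ... | _       | inj₁ sq | inj₁ tq = contradiction (sq ◅◅ ∼-sym tq) s≁t
      ... | _       | inj₂ sq | inj₂ tq = contradiction (join _ _ sq tq) s≁t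

-- Finite integer sums and indicators

module IntegerCounts where
  open import Data.Integer as ℤ using (ℤ; _+_; _*_; _-_; 0ℤ; 1ℤ)
  open import Data.Integer.Properties using (+-identityˡ; +-identityʳ; *-identityˡ; *-identityʳ; *-zeroʳ)
  open import Data.Integer.Tactic.RingSolver using (solve-∀)

  private
    variable
      I J : Set

  ∑ : List I → (I → ℤ) → ℤ
  ∑ []       f = 0ℤ
  ∑ (x ∷ xs) f = f x + ∑ xs f

  ∑-cong : ∀ (xs : List I) {f g : I → ℤ} → (∀ a → f a ≡ g a) → ∑ xs f ≡ ∑ xs g
  ∑-cong []       h = refl
  ∑-cong (x ∷ xs) h = cong₂ _+_ (h x) (∑-cong xs h)

  ∑-+ : ∀ (xs : List I) (f g : I → ℤ) → ∑ xs (λ a → f a + g a) ≡ ∑ xs f + ∑ xs g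
  ∑-+ []       f g = refl
  ∑-+ (x ∷ xs) f g = trans (cong ((f x + g x) +_) (∑-+ xs f g)) (interchange (f x) (g x) (∑ xs f) (∑ xs g))
    where
    interchange : ∀ a b c d → (a + b) + (c + d) ≡ (a + c) + (b + d)
    interchange = solve-∀

  ∑-- : ∀ (xs : List I) (f g : I → ℤ) → ∑ xs (λ a → f a - g a) ≡ ∑ xs f - ∑ xs g
  ∑-- []       f g = refl
  ∑-- (x ∷ xs) f g = trans (cong ((f x - g x) +_) (∑-- xs f g)) (interchange (f x) (g x) (∑ xs f) (∑ xs g))
    where
    interchange : ∀ a b c d → (a - b) + (c - d) ≡ (a + c) - (b + d)
    interchange = solve-∀

  ∑-*ˡ : ∀ (xs : List I) c (f : I → ℤ) → ∑ xs (λ a → c * f a) ≡ c * ∑ xs f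
  ∑-*ˡ []       c f = sym (*-zeroʳ c)
  ∑-*ˡ (x ∷ xs) c f = trans (cong (c * f x +_) (∑-*ˡ xs c f)) (distrib c (f x) (∑ xs f))
    where
    distrib : ∀ c a b → c * a + c * b ≡ c * (a + b)
    distrib = solve-∀

  ∑-*ʳ : ∀ (xs : List I) c (f : I → ℤ) → ∑ xs (λ a → f a * c) ≡ ∑ xs f * c
  ∑-*ʳ []       c f = refl
  ∑-*ʳ (x ∷ xs) c f = trans (cong (f x * c +_) (∑-*ʳ xs c f)) (distrib c (f x) (∑ xs f))
    where
    distrib : ∀ c a b → a * c + b * c ≡ (a + b) * c
    distrib = solve-∀

  ∑-0 : ∀ (xs : List I) → ∑ xs (λ _ → 0ℤ) ≡ 0ℤ
  ∑-0 []       = refl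
  ∑-0 (x ∷ xs) = trans (+-identityˡ _) (∑-0 xs)

  ∑-swap : ∀ (xs : List I) (ys : List J) (f : I → J → ℤ) →
           ∑ xs (λ a → ∑ ys (f a)) ≡ ∑ ys (λ b → ∑ xs (λ a → f a b))
  ∑-swap []       ys f = sym (∑-0 ys)
  ∑-swap (x ∷ xs) ys f = trans (cong (∑ ys (f x) +_) (∑-swap xs ys f)) (sym (∑-+ ys (f x) (λ b → ∑ xs (λ a → f a b))))

  ∑-++ : ∀ (xs ys : List I) f → ∑ (xs ++ ys) f ≡ ∑ xs f + ∑ ys f
  ∑-++ []       ys f = sym (+-identityˡ _)
  ∑-++ (x ∷ xs) ys f = trans (cong (f x +_) (∑-++ xs ys f)) (assoc (f x) (∑ xs f) (∑ ys f))
    where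
    assoc : ∀ a b c → a + (b + c) ≡ a + b + c
    assoc = solve-∀

  ∑-map : ∀ (h : I → J) xs f → ∑ (map h xs) f ≡ ∑ xs (f ∘ h)
  ∑-map h []       f = refl
  ∑-map h (x ∷ xs) f = cong (f (h x) +_) (∑-map h xs f)

  ∑-allFin-suc : ∀ k (f : Fin (suc k) → ℤ) → ∑ (allFin (suc k)) f ≡ f zero + ∑ (allFin k) (f ∘ suc)
  ∑-allFin-suc k f = cong (f zero +_)
    (trans (cong (λ l → ∑ l f) (sym (map-tabulate id suc))) (∑-map suc (allFin k) f))

  ⟦_⟧ : Bool → ℤ
  ⟦ true  ⟧ = 1ℤ
  ⟦ false ⟧ = 0ℤ

  ⟦⟧-yes : ∀ {b} → T b → ⟦ b ⟧ ≡ 1ℤ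
  ⟦⟧-yes {true} _ = refl

  ⟦⟧-no : ∀ {b} → ¬ T b → ⟦ b ⟧ ≡ 0ℤ
  ⟦⟧-no {true}  ¬t = contradiction _ ¬t
  ⟦⟧-no {false} _  = refl

  ⟦⟧-not : ∀ b → ⟦ not b ⟧ ≡ 1ℤ - ⟦ b ⟧
  ⟦⟧-not true  = refl
  ⟦⟧-not false = refl

  ⟦⟧-∧ : ∀ b c → ⟦ b ∧ c ⟧ ≡ ⟦ b ⟧ * ⟦ c ⟧
  ⟦⟧-∧ true  c = sym (*-identityˡ _)
  ⟦⟧-∧ false c = refl

  ⟦⟧-⇔ : ∀ {b c} → (T b → T c) → (T c → T b) → ⟦ b ⟧ ≡ ⟦ c ⟧
  ⟦⟧-⇔ {b} {c} b→c c→b with T? b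
  ... | yes t = trans (⟦⟧-yes t) (sym (⟦⟧-yes (b→c t)))
  ... | no ¬t = trans (⟦⟧-no ¬t) (sym (⟦⟧-no (¬t ∘ c→b)))

  -- An indicator factor licenses rewriting the other factor under the condition it indicates; this
  -- is how the properties of trees and forests enter sums over all edge sets.
  ⟦⟧*-cong : ∀ b {x y} → (T b → x ≡ y) → ⟦ b ⟧ * x ≡ ⟦ b ⟧ * y
  ⟦⟧*-cong true  h = cong (1ℤ *_) (h _)
  ⟦⟧*-cong false h = refl

  length-filterᵇ : ∀ (p : I → Bool) xs → ℤ.+ length (filterᵇ p xs) ≡ ∑ xs (λ a → ⟦ p a ⟧)
  length-filterᵇ p []       = refl
  length-filterᵇ p (x ∷ xs) with p x
  ... | true  = cong (λ z → 1ℤ + z) (length-filterᵇ p xs)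
  ... | false = trans (length-filterᵇ p xs) (sym (+-identityˡ _))

  δ : ∀ {k} → Fin k → Fin k → ℤ
  δ i j = ⟦ ⌊ i ≟ j ⌋ ⟧

  δ-refl : ∀ {k} (i : Fin k) → δ i i ≡ 1ℤ
  δ-refl i with i ≟ i
  ... | yes _  = refl
  ... | no i≢i = contradiction refl i≢i

  δ-suc : ∀ {k} (i j : Fin k) → δ (suc i) (suc j) ≡ δ i j
  δ-suc i j with i ≟ j
  ... | yes _ = refl
  ... | no  _ = refl

  ∑-δ : ∀ {k} (i : Fin k) (h : Fin k → ℤ) → ∑ (allFin k) (λ j → δ i j * h j) ≡ h i
  ∑-δ {suc k} zero h = begin
    ∑ (allFin (suc k)) (λ j → δ zero j * h j)          ≡⟨ ∑-allFin-suc k (λ j → δ zero j * h j) ⟩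
    1ℤ * h zero + ∑ (allFin k) (λ j → 0ℤ * h (suc j)) ≡⟨ cong₂ _+_ (*-identityˡ (h zero)) (∑-0 (allFin k)) ⟩
    h zero + 0ℤ                                        ≡⟨ +-identityʳ _ ⟩
    h zero                                             ∎
  ∑-δ {suc k} (suc i) h = begin
    ∑ (allFin (suc k)) (λ j → δ (suc i) j * h j)
      ≡⟨ ∑-allFin-suc k (λ j → δ (suc i) j * h j) ⟩
    0ℤ * h zero + ∑ (allFin k) (λ j → δ (suc i) (suc j) * h (suc j))
      ≡⟨ +-identityˡ _ ⟩
    ∑ (allFin k) (λ j → δ (suc i) (suc j) * h (suc j))
      ≡⟨ ∑-cong (allFin k) (λ j → cong (_* h (suc j)) (δ-suc i j)) ⟩
    ∑ (allFin k) (λ j → δ i j * h (suc j))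
      ≡⟨ ∑-δ i (h ∘ suc) ⟩
    h (suc i) ∎

  -- Sums over edge sets

  module Counting (G : Graph) where
    open Graph G
    open Forests G

    ∑-allSubsets-suc : ∀ k (g : Vec Bool (suc k) → ℤ) → ∑ (allSubsets G (suc k)) g ≡
                       ∑ (allSubsets G k) (g ∘ (false ∷_)) + ∑ (allSubsets G k) (g ∘ (true ∷_))
    ∑-allSubsets-suc k g = trans (∑-++ (map (false ∷_) (allSubsets G k)) _ g)
      (cong₂ _+_ (∑-map (false ∷_) (allSubsets G k) g) (∑-map (true ∷_) (allSubsets G k) g))

    -- Adding `f` is a bijection from the sets without `f` onto the sets with `f`. The induction
    -- walks to the coordinate of `f`, where the two halves of the sum trade places.
    ∑-insert : ∀ {k} (f : Fin k) (g : Vec Bool k → ℤ) →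
               ∑ (allSubsets G k) (λ F → ⟦ lookup F f ⟧ * g F) ≡
               ∑ (allSubsets G k) (λ F → ⟦ not (lookup F f) ⟧ * g (F [ f ]≔ true))
    ∑-insert {suc k} zero g = begin
      ∑ (allSubsets G (suc k)) (λ F → ⟦ lookup F zero ⟧ * g F)
        ≡⟨ ∑-allSubsets-suc k (λ F → ⟦ lookup F zero ⟧ * g F) ⟩
      ∑ S (λ F → 0ℤ * g (false ∷ F)) + ∑ S (λ F → 1ℤ * g (true ∷ F))
        ≡⟨ cong (_+ ∑ S (λ F → 1ℤ * g (true ∷ F))) (∑-0 S) ⟩
      0ℤ + ∑ S (λ F → 1ℤ * g (true ∷ F))
        ≡⟨ trans (+-identityˡ (∑ S (λ F → 1ℤ * g (true ∷ F)))) (sym (+-identityʳ (∑ S (λ F → 1ℤ * g (true ∷ F))))) ⟩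
      ∑ S (λ F → 1ℤ * g (true ∷ F)) + 0ℤ
        ≡⟨ cong (∑ S (λ F → 1ℤ * g (true ∷ F)) +_) (sym (∑-0 S)) ⟩
      ∑ S (λ F → 1ℤ * g (true ∷ F)) + ∑ S (λ F → 0ℤ * g (true ∷ F))
        ≡⟨ sym (∑-allSubsets-suc k (λ F → ⟦ not (lookup F zero) ⟧ * g (F [ zero ]≔ true))) ⟩
      ∑ (allSubsets G (suc k)) (λ F → ⟦ not (lookup F zero) ⟧ * g (F [ zero ]≔ true)) ∎
      where S = allSubsets G k
    ∑-insert {suc k} (suc f) g = begin
      ∑ (allSubsets G (suc k)) (λ F → ⟦ lookup F (suc f) ⟧ * g F)
        ≡⟨ ∑-allSubsets-suc k (λ F → ⟦ lookup F (suc f) ⟧ * g F) ⟩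
      ∑ S (λ F → ⟦ lookup F f ⟧ * g (false ∷ F)) + ∑ S (λ F → ⟦ lookup F f ⟧ * g (true ∷ F))
        ≡⟨ cong₂ _+_ (∑-insert f (g ∘ (false ∷_))) (∑-insert f (g ∘ (true ∷_))) ⟩
      ∑ S (λ F → ⟦ not (lookup F f) ⟧ * g (false ∷ F [ f ]≔ true)) +
      ∑ S (λ F → ⟦ not (lookup F f) ⟧ * g (true ∷ F [ f ]≔ true))
        ≡⟨ sym (∑-allSubsets-suc k (λ F → ⟦ not (lookup F (suc f)) ⟧ * g (F [ suc f ]≔ true))) ⟩
      ∑ (allSubsets G (suc k)) (λ F → ⟦ not (lookup F (suc f)) ⟧ * g (F [ suc f ]≔ true)) ∎
      where S = allSubsets G k

    V : List (Fin n)
    V = allFin n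

    E : List (Fin m)
    E = allFin m

    𝓢 : List (EdgeSet G)
    𝓢 = allSubsets G m

    R : EdgeSet G → Fin n → Fin n → ℤ
    R F x y = ⟦ reach G F x y ⟧

    R-yes : ∀ {F x y} → F ⊢ x ∼ y → R F x y ≡ 1ℤ
    R-yes = ⟦⟧-yes ∘ from reach⇔∼

    R-no : ∀ {F x y} → ¬ F ⊢ x ∼ y → R F x y ≡ 0ℤ
    R-no x≁y = ⟦⟧-no (x≁y ∘ to reach⇔∼)

    R-sym : ∀ F x y → R F x y ≡ R F y x
    R-sym F x y = ⟦⟧-⇔ (reach-sym {F} {x} {y}) (reach-sym {F} {y} {x})

    R-congˡ : ∀ {F x y} z → F ⊢ x ∼ y → R F x z ≡ R F y z
    R-congˡ {F} {x} {y} z xy with ∼? F y z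
    ... | inj₁ yz = trans (R-yes (xy ◅◅ yz)) (sym (R-yes yz))
    ... | inj₂ y≁z = trans (R-no (y≁z ∘ (∼-sym xy ◅◅_))) (sym (R-no y≁z))

    R-congʳ : ∀ {F x y} z → F ⊢ x ∼ y → R F z x ≡ R F z y
    R-congʳ {F} {x} {y} z xy = trans (R-sym F z x) (trans (R-congˡ z xy) (R-sym F y z))

    -- Signed edge crossings of paths in a forest

    d : (Fin n → ℤ) → Fin m → ℤ
    d u f = u (src f) - u (tgt f)

    -- For f ∉ X with X + f a forest: +1, -1 or 0 according to whether the path of
    -- X + f from x to b traverses f forwards, backwards or not at all.
    cross : EdgeSet G → Fin m → Fin n → Fin n → ℤ
    cross X f b x = R X x (src f) * R X (tgt f) b - R X x (tgt f) * R X (src f) b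

    cross-root : ∀ X f b → cross X f b b ≡ 0ℤ
    cross-root X f b rewrite R-sym X b (src f) | R-sym X b (tgt f) =
      commute (R X (src f) b) (R X (tgt f) b)
      where
      commute : ∀ s t → s * t - t * s ≡ 0ℤ
      commute = solve-∀

    -- In F - g the ends of `g` are separated, so the difference reduces to the number of ends of
    -- `g` that are connected to `b`. There is exactly one: `∼-delete` provides it, and two would
    -- join the ends.
    d-cross-self : ∀ {F} g b → Forest F → T (lookup F g) → F ⊢ src g ∼ b →
                   d (cross (F [ g ]≔ false) g b) g ≡ 1ℤ
    d-cross-self {F} g b forest g∈F sb
      rewrite R-yes {F [ g ]≔ false} {src g} ε | R-yes {F [ g ]≔ false} {tgt g} ε
            | R-no (forest g g∈F) | R-no (forest g g∈F ∘ ∼-sym) = finish side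
      where
      X = F [ g ]≔ false
      side : X ⊢ src g ∼ b ⊎ X ⊢ tgt g ∼ b
      side = [ inj₁ , (λ (_ , b-end) → [ inj₁ ∘ ∼-sym , inj₂ ∘ ∼-sym ]′ b-end) ]′ (∼-delete F g g∈F sb)
      finish : X ⊢ src g ∼ b ⊎ X ⊢ tgt g ∼ b →
               (1ℤ * R X (tgt g) b - 0ℤ * R X (src g) b) - (0ℤ * R X (tgt g) b - 1ℤ * R X (src g) b) ≡ 1ℤ
      finish (inj₁ s∼b) rewrite R-yes s∼b | R-no (λ t∼b → forest g g∈F (s∼b ◅◅ ∼-sym t∼b)) = refl
      finish (inj₂ t∼b) rewrite R-yes t∼b | R-no (λ s∼b → forest g g∈F (s∼b ◅◅ ∼-sym t∼b)) = refl

    -- For a forest F connecting `x` to `b`, the sum of the increments of `u` along the path between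
    -- them, written over all edges so that it can be exchanged with the sum over edge sets.
    flow : EdgeSet G → (Fin n → ℤ) → Fin n → Fin n → ℤ
    flow F u b x = ∑ E (λ f → ⟦ lookup F f ⟧ * (d u f * cross (F [ f ]≔ false) f b x))

    -- Moving the start across `g` changes the term of `g` alone: for any other `f` the edge `g`
    -- survives in F - f and keeps both starts in the same component.
    flow-edge : ∀ {F} u b → Forest F → ∀ g → T (lookup F g) → F ⊢ src g ∼ b →
                flow F u b (src g) ≡ flow F u b (tgt g) + d u g
    flow-edge {F} u b forest g g∈F sb = begin
      flow F u b (src g)
        ≡⟨ ∑-cong E term ⟩
      ∑ E (λ f → ⟦ lookup F f ⟧ * (d u f * cross (F [ f ]≔ false) f b (tgt g)) + δ g f * d u f)
        ≡⟨ ∑-+ E (λ f → ⟦ lookup F f ⟧ * (d u f * cross (F [ f ]≔ false) f b (tgt g))) (λ f → δ g f * d u f) ⟩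
      flow F u b (tgt g) + ∑ E (λ f → δ g f * d u f)
        ≡⟨ cong (flow F u b (tgt g) +_) (∑-δ g (d u)) ⟩
      flow F u b (tgt g) + d u g ∎
      where
      same : ∀ a c c′ → c - c′ ≡ 1ℤ → 1ℤ * (a * c) ≡ 1ℤ * (a * c′) + 1ℤ * a
      same a c c′ h = trans (lhs a c c′) (cong (λ z → 1ℤ * (a * c′) + z * a) h)
        where
        lhs : ∀ a c c′ → 1ℤ * (a * c) ≡ 1ℤ * (a * c′) + (c - c′) * a
        lhs = solve-∀
      term : ∀ f → ⟦ lookup F f ⟧ * (d u f * cross (F [ f ]≔ false) f b (src g)) ≡
                   ⟦ lookup F f ⟧ * (d u f * cross (F [ f ]≔ false) f b (tgt g)) + δ g f * d u f
      term f with g ≟ f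
      ... | yes refl rewrite ⟦⟧-yes g∈F =
        same (d u g) (cross (F [ g ]≔ false) g b (src g)) (cross (F [ g ]≔ false) g b (tgt g))
             (d-cross-self g b forest g∈F sb)
      ... | no g≢f = trans (cong (λ c → ⟦ lookup F f ⟧ * (d u f * c))
        (cong₂ (λ y z → y * R X (tgt f) b - z * R X (src f) b) (R-congˡ (src f) st) (R-congˡ (tgt f) st)))
        (sym (+-identityʳ _))
        where
        X = F [ f ]≔ false
        st : X ⊢ src g ∼ tgt g
        st = edge (∈-delete F g≢f g∈F)

    -- Induction on any walk from `x` to `b`, shifting the start by `flow-edge`; a backward step
    -- solves the same equation for the other end. The empty walk crosses nothing.
    flow-telescopes : ∀ {F} u {b x} → Forest F → F ⊢ x ∼ b → flow F u b x ≡ u x - u b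
    flow-telescopes {F} u {b} forest ε =
      trans (∑-cong E λ f → trans (cong (λ c → ⟦ lookup F f ⟧ * (d u f * c)) (cross-root (F [ f ]≔ false) f b))
                                  (zeros ⟦ lookup F f ⟧ (d u f)))
            (trans (∑-0 E) (sym (self (u b))))
      where
      zeros : ∀ a c → a * (c * 0ℤ) ≡ 0ℤ
      zeros = solve-∀
      self : ∀ a → a - a ≡ 0ℤ
      self = solve-∀
    flow-telescopes {F} u {b} forest (fwd (joins g g∈F) ◅ p) =
      trans (flow-edge u b forest g g∈F (edge g∈F ◅◅ p))
            (trans (cong (_+ d u g) (flow-telescopes u forest p)) (tele (u (tgt g)) (u b) (u (src g))))
      where
      tele : ∀ t b s → t - b + (s - t) ≡ s - b
      tele = solve-∀
    flow-telescopes {F} u {b} forest (bwd (joins g g∈F) ◅ p) =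
      solveFor (flow F u b (tgt g)) (u (src g)) (u (tgt g)) (u b)
        (trans (sym (flow-edge u b forest g g∈F p)) (flow-telescopes u forest p))
      where
      solveFor : ∀ y s t b → y + (s - t) ≡ s - b → y ≡ t - b
      solveFor y s t b h = trans (lhs y s t) (trans (cong (_- (s - t)) h) (rhs s t b))
        where
        lhs : ∀ y s t → y ≡ y + (s - t) - (s - t)
        lhs = solve-∀
        rhs : ∀ s t b → (s - b) - (s - t) ≡ t - b
        rhs = solve-∀

  -- Green functions grounded at the root

  module Rooted (G : Graph) (q : Fin (Graph.n G)) where
    open Graph G
    open Forests G
    open Counting G

    tree two : EdgeSet G → ℤ
    tree F = ⟦ isTree F ⟧
    two  F = ⟦ isTwoForest F ⟧

    -- The contribution of a single forest to the Green function: 1 if `x` and `y` share a component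
    -- away from `q`, and 0 otherwise.
    w : EdgeSet G → Fin n → Fin n → ℤ
    w F x y = R F x y * (1ℤ - R F x q)

    w-sym : ∀ F x y → w F x y ≡ w F y x
    w-sym F x y with ∼? F x y
    ... | inj₁ xy = cong₂ (λ a b → a * (1ℤ - b)) (R-sym F x y) (R-congˡ q xy)
    ... | inj₂ x≁y rewrite R-no x≁y | R-no (x≁y ∘ ∼-sym) = refl

    w-root : ∀ F x → w F x q ≡ 0ℤ
    w-root F x with reach G F x q
    ... | true  = refl
    ... | false = refl

    w-self : ∀ F x → w F x x ≡ 1ℤ - R F x q
    w-self F x rewrite R-yes {F} {x} ε = *-identityˡ (1ℤ - R F x q)

    -- If F already connects the ends of `f`, both differences vanish. Otherwise F + f is a tree
    -- exactly when F is a two-component forest, and then the path from `x` to `q` crosses `f` only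
    -- if `x` is away from `q`, in the direction whose sign is `d (w F x) f`.
    exchange : ∀ F f x → ¬ T (lookup F f) →
               tree (F [ f ]≔ true) * cross F f q x ≡ two F * d (w F x) f
    exchange F f x f∉F with ∼? F (src f) (tgt f)
    ... | inj₁ st rewrite R-congʳ x st | R-congˡ q st =
      cancel (tree (F [ f ]≔ true)) (R F x (tgt f)) (R F (tgt f) q) (two F) (1ℤ - R F x q)
      where
      cancel : ∀ a b c d e → a * (b * c - b * c) ≡ d * (b * e - b * e)
      cancel = solve-∀
    ... | inj₂ s≁t with T? (isTwoForest F)
    ...   | no ¬two rewrite ⟦⟧-no ¬two
            | ⟦⟧-no (λ t → ¬two (from (isTwoForest⇔ q) (proj₁ (to (Tree-insert⇔ q F f f∉F) (to (isTree⇔ q) t))))) = refl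
    ...   | yes t rewrite ⟦⟧-yes t
            | ⟦⟧-yes (from (isTree⇔ q) (from (Tree-insert⇔ q F f f∉F) (to (isTwoForest⇔ q) t , s≁t))) =
      cong (1ℤ *_) (sides (proj₂ (proj₂ (to (isTwoForest⇔ q) t))))
      where
      sides : (∀ v w → ¬ F ⊢ v ∼ q → ¬ F ⊢ w ∼ q → F ⊢ v ∼ w) → cross F f q x ≡ d (w F x) f
      sides join with ∼? F x q | ∼? F (src f) q | ∼? F (tgt f) q
      ... | _       | inj₁ sq | inj₁ tq = contradiction (sq ◅◅ ∼-sym tq) s≁t
      ... | _       | inj₂ sq | inj₂ tq = contradiction (join _ _ sq tq) s≁t
      ... | inj₁ xq | inj₁ sq | inj₂ tq
        rewrite R-yes xq | R-yes sq | R-no tq | R-yes (xq ◅◅ ∼-sym sq) | R-no (λ xt → tq (∼-sym xt ◅◅ xq)) = refl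
      ... | inj₁ xq | inj₂ sq | inj₁ tq
        rewrite R-yes xq | R-no sq | R-yes tq | R-yes (xq ◅◅ ∼-sym tq) | R-no (λ xs → sq (∼-sym xs ◅◅ xq)) = refl
      ... | inj₂ xq | inj₁ sq | inj₂ tq
        rewrite R-no xq | R-yes sq | R-no tq | R-yes (join _ _ xq tq) | R-no (λ xs → xq (xs ◅◅ sq)) = refl
      ... | inj₂ xq | inj₂ sq | inj₁ tq
        rewrite R-no xq | R-no sq | R-yes tq | R-yes (join _ _ xq sq) | R-no (λ xt → xq (xt ◅◅ tq)) = refl

    κ[_] : (EdgeSet G → ℤ) → ℤ
    κ[ χ ] = ∑ 𝓢 (λ F → χ F * tree F)

    -- With weight 1 this is the g(x,y) of the overview; a weight that kills the edge sets through
    -- some edge gives its counterpart for the graph without that edge.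
    P : (EdgeSet G → ℤ) → Fin n → Fin n → ℤ
    P χ x y = ∑ 𝓢 (λ F → χ F * (two F * w F x y))

    P-sym : ∀ χ x y → P χ x y ≡ P χ y x
    P-sym χ x y = ∑-cong 𝓢 λ F → cong (λ z → χ F * (two F * z)) (w-sym F x y)

    P-root : ∀ χ x → P χ x q ≡ 0ℤ
    P-root χ x = trans (∑-cong 𝓢 λ F → trans (cong (λ z → χ F * (two F * z)) (w-root F x)) (zeros (χ F) (two F))) (∑-0 𝓢)
      where
      zeros : ∀ a b → a * (b * 0ℤ) ≡ 0ℤ
      zeros = solve-∀

    -- Choosing χ F = [e ∉ F] and α f = [f ≠ e] yields the deletion G - e on the same edge type.
    module _ (χ : EdgeSet G → ℤ) (α : Fin m → ℤ)
             (χ-insert : ∀ F f → ¬ T (lookup F f) → χ (F [ f ]≔ true) ≡ α f * χ F)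
             (u : Fin n → ℤ) (x : Fin n) where

      private
        term : Fin m → EdgeSet G → ℤ
        term f F = χ F * (tree F * (d u f * cross (F [ f ]≔ false) f q x))

        -- For `f` in F the left factor is 0, and the right side is 0 because `f` connects its own
        -- ends. For `f` outside F, removing `f` from F + f restores F and `exchange` applies.
        term-insert : ∀ f F → ⟦ not (lookup F f) ⟧ * term f (F [ f ]≔ true) ≡
                              α f * (d u f * (χ F * (two F * w F x (src f)) - χ F * (two F * w F x (tgt f))))
        term-insert f F with T? (lookup F f)
        ... | yes f∈F rewrite ⟦⟧-not (lookup F f) | ⟦⟧-yes f∈F | R-congʳ x (edge {F} {f} f∈F) =
          cancel (term f (F [ f ]≔ true)) (α f) (d u f) (χ F * (two F * w F x (tgt f)))
          where
          cancel : ∀ a b c e → 0ℤ * a ≡ b * (c * (e - e))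
          cancel = solve-∀
        ... | no f∉F rewrite ⟦⟧-not (lookup F f) | ⟦⟧-no f∉F = begin
          1ℤ * term f F⁺
            ≡⟨ cong (λ X → 1ℤ * (χ F⁺ * (tree F⁺ * (d u f * cross X f q x)))) (trans ([]≔-idempotent F f) (delete-∉ F f f∉F)) ⟩
          1ℤ * (χ F⁺ * (tree F⁺ * (d u f * cross F f q x)))
            ≡⟨ cong (λ z → 1ℤ * (z * (tree F⁺ * (d u f * cross F f q x)))) (χ-insert F f f∉F) ⟩
          1ℤ * (α f * χ F * (tree F⁺ * (d u f * cross F f q x)))
            ≡⟨ rearrange (α f) (χ F) (tree F⁺) (d u f) (cross F f q x) ⟩
          α f * (d u f * (χ F * (tree F⁺ * cross F f q x)))
            ≡⟨ cong (λ z → α f * (d u f * (χ F * z))) (exchange F f x f∉F) ⟩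
          α f * (d u f * (χ F * (two F * d (w F x) f)))
            ≡⟨ cong (λ z → α f * (d u f * z)) (distrib (χ F) (two F) (w F x (src f)) (w F x (tgt f))) ⟩
          α f * (d u f * (χ F * (two F * w F x (src f)) - χ F * (two F * w F x (tgt f)))) ∎
          where
          F⁺ = F [ f ]≔ true
          rearrange : ∀ a b c d e → 1ℤ * (a * b * (c * (d * e))) ≡ a * (d * (b * (c * e)))
          rearrange = solve-∀
          distrib : ∀ a b c d → a * (b * (c - d)) ≡ a * (b * c) - a * (b * d)
          distrib = solve-∀

      -- In weak form: P χ x is κ[ χ ] times the Green function of the Laplacian grounded at q.
      energy : ∑ E (λ f → α f * (d u f * d (P χ x) f)) ≡ κ[ χ ] * (u x - u q)
      energy = begin
        ∑ E (λ f → α f * (d u f * d (P χ x) f))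
          ≡⟨ ∑-cong E (λ f → sym (byEdge f)) ⟩
        ∑ E (λ f → ∑ 𝓢 (λ F → ⟦ lookup F f ⟧ * term f F))
          ≡⟨ ∑-swap E 𝓢 (λ f F → ⟦ lookup F f ⟧ * term f F) ⟩
        ∑ 𝓢 (λ F → ∑ E (λ f → ⟦ lookup F f ⟧ * term f F))
          ≡⟨ ∑-cong 𝓢 bySet ⟩
        ∑ 𝓢 (λ F → χ F * tree F * (u x - u q))
          ≡⟨ ∑-*ʳ 𝓢 (u x - u q) (λ F → χ F * tree F) ⟩
        κ[ χ ] * (u x - u q) ∎
        where
        -- With `f` fixed, trees through `f` are traded for two-component forests that `f` joins up.
        byEdge : ∀ f → ∑ 𝓢 (λ F → ⟦ lookup F f ⟧ * term f F) ≡ α f * (d u f * d (P χ x) f)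
        byEdge f = begin
          ∑ 𝓢 (λ F → ⟦ lookup F f ⟧ * term f F)
            ≡⟨ ∑-insert f (term f) ⟩
          ∑ 𝓢 (λ F → ⟦ not (lookup F f) ⟧ * term f (F [ f ]≔ true))
            ≡⟨ ∑-cong 𝓢 (term-insert f) ⟩
          ∑ 𝓢 (λ F → α f * (d u f * (p (src f) F - p (tgt f) F)))
            ≡⟨ ∑-*ˡ 𝓢 (α f) (λ F → d u f * (p (src f) F - p (tgt f) F)) ⟩
          α f * ∑ 𝓢 (λ F → d u f * (p (src f) F - p (tgt f) F))
            ≡⟨ cong (α f *_) (∑-*ˡ 𝓢 (d u f) (λ F → p (src f) F - p (tgt f) F)) ⟩
          α f * (d u f * ∑ 𝓢 (λ F → p (src f) F - p (tgt f) F))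
            ≡⟨ cong (λ z → α f * (d u f * z)) (∑-- 𝓢 (p (src f)) (p (tgt f))) ⟩
          α f * (d u f * d (P χ x) f) ∎
          where
          p : Fin n → EdgeSet G → ℤ
          p y F = χ F * (two F * w F x y)

        -- With the tree fixed, the sum over edges telescopes along its path from `x` to `q`.
        bySet : ∀ F → ∑ E (λ f → ⟦ lookup F f ⟧ * term f F) ≡ χ F * tree F * (u x - u q)
        bySet F = begin
          ∑ E (λ f → ⟦ lookup F f ⟧ * term f F)
            ≡⟨ ∑-cong E (λ f → rearrange ⟦ lookup F f ⟧ (χ F) (tree F) (d u f * cross (F [ f ]≔ false) f q x)) ⟩
          ∑ E (λ f → χ F * tree F * (⟦ lookup F f ⟧ * (d u f * cross (F [ f ]≔ false) f q x)))
            ≡⟨ ∑-*ˡ E (χ F * tree F) (λ f → ⟦ lookup F f ⟧ * (d u f * cross (F [ f ]≔ false) f q x)) ⟩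
          χ F * tree F * flow F u q x
            ≡⟨ assoc (χ F) (tree F) (flow F u q x) ⟩
          χ F * (tree F * flow F u q x)
            ≡⟨ cong (χ F *_) (⟦⟧*-cong (isTree F) λ t →
                 let (forest , conn) = to (isTree⇔ q) t in flow-telescopes u forest (conn x q)) ⟩
          χ F * (tree F * (u x - u q))
            ≡⟨ sym (assoc (χ F) (tree F) (u x - u q)) ⟩
          χ F * tree F * (u x - u q) ∎
          where
          rearrange : ∀ a b c d → a * (b * (c * d)) ≡ b * c * (a * d)
          rearrange = solve-∀
          assoc : ∀ a b c → a * b * c ≡ a * (b * c)
          assoc = solve-∀

    -- Resistances in terms of the Green function

    𝟙 : EdgeSet G → ℤ
    𝟙 _ = 1ℤ

    K : ℤ
    K = κ[ 𝟙 ]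

    g : Fin n → Fin n → ℤ
    g = P 𝟙

    energy-g : ∀ u x → ∑ E (λ f → d u f * d (g x) f) ≡ K * (u x - u q)
    energy-g u x = trans (∑-cong E (λ f → sym (*-identityˡ (d u f * d (g x) f))))
                         (energy 𝟙 (λ _ → 1ℤ) (λ _ _ _ → refl) u x)

    separating : Fin n → Fin n → ℤ
    separating x y = ∑ 𝓢 (λ F → two F * (1ℤ - R F x y))

    separating-root : ∀ x → separating x q ≡ g x x
    separating-root x = ∑-cong 𝓢 λ F → trans (cong (two F *_) (sym (w-self F x))) (sym (*-identityˡ (two F * w F x x)))

    -- Checked for each forest by the positions of `x` and `y` relative to `q`: since only one
    -- component misses `q`, two vertices both away from `q` are together, and the four terms
    -- cancel.
    separating-g : ∀ x y → separating x y ≡ g x x + g y y - (g x y + g x y)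
    separating-g x y = begin
      separating x y
        ≡⟨ ∑-cong 𝓢 pointwise ⟩
      ∑ 𝓢 (λ F → (p x x F + p y y F) - (p x y F + p x y F))
        ≡⟨ ∑-- 𝓢 (λ F → p x x F + p y y F) (λ F → p x y F + p x y F) ⟩
      ∑ 𝓢 (λ F → p x x F + p y y F) - ∑ 𝓢 (λ F → p x y F + p x y F)
        ≡⟨ cong₂ _-_ (∑-+ 𝓢 (p x x) (p y y)) (∑-+ 𝓢 (p x y) (p x y)) ⟩
      g x x + g y y - (g x y + g x y) ∎
      where
      p : Fin n → Fin n → EdgeSet G → ℤ
      p a b F = 1ℤ * (two F * w F a b)
      distrib : ∀ t a b c → t * (a + b - (c + c)) ≡ (1ℤ * (t * a) + 1ℤ * (t * b)) - (1ℤ * (t * c) + 1ℤ * (t * c))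
      distrib = solve-∀
      cases : ∀ F → TwoForest q F → 1ℤ - R F x y ≡ w F x x + w F y y - (w F x y + w F x y)
      cases F (_ , _ , join) with ∼? F x q | ∼? F y q
      ... | inj₁ xq | inj₁ yq
        rewrite R-yes {F} {x} ε | R-yes {F} {y} ε | R-yes xq | R-yes yq | R-yes (xq ◅◅ ∼-sym yq) = refl
      ... | inj₁ xq | inj₂ yq
        rewrite R-yes {F} {x} ε | R-yes {F} {y} ε | R-yes xq | R-no yq | R-no (λ xy → yq (∼-sym xy ◅◅ xq)) = refl
      ... | inj₂ xq | inj₁ yq
        rewrite R-yes {F} {x} ε | R-yes {F} {y} ε | R-no xq | R-yes yq | R-no (λ xy → xq (xy ◅◅ yq)) = refl
      ... | inj₂ xq | inj₂ yq
        rewrite R-yes {F} {x} ε | R-yes {F} {y} ε | R-no xq | R-no yq | R-yes (join x y xq yq) = refl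
      pointwise : ∀ F → two F * (1ℤ - R F x y) ≡ (p x x F + p y y F) - (p x y F + p x y F)
      pointwise F = trans (⟦⟧*-cong (isTwoForest F) (cases F ∘ to (isTwoForest⇔ q)))
                          (distrib (two F) (w F x x) (w F y y) (w F x y))

    -- Deleting `e` matches the trees through `e` with the two-component forests that separate its
    -- ends.
    trees-through : ∀ e → ∑ 𝓢 (λ F → ⟦ lookup F e ⟧ * tree F) ≡ separating (src e) (tgt e)
    trees-through e = trans (∑-insert e tree) (∑-cong 𝓢 pointwise)
      where
      pointwise : ∀ F → ⟦ not (lookup F e) ⟧ * tree (F [ e ]≔ true) ≡ two F * (1ℤ - R F (src e) (tgt e))
      pointwise F with T? (lookup F e)
      ... | yes e∈F rewrite ⟦⟧-not (lookup F e) | ⟦⟧-yes e∈F | R-yes (edge {F} {e} e∈F) = sym (*-zeroʳ (two F))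
      ... | no e∉F rewrite ⟦⟧-not (lookup F e) | ⟦⟧-no e∉F = trans (*-identityˡ (tree (F [ e ]≔ true))) (cases (∼? F (src e) (tgt e)))
        where
        cases : F ⊢ src e ∼ tgt e ⊎ ¬ F ⊢ src e ∼ tgt e → tree (F [ e ]≔ true) ≡ two F * (1ℤ - R F (src e) (tgt e))
        cases (inj₁ st) rewrite R-yes st =
          trans (⟦⟧-no λ t → proj₂ (to (Tree-insert⇔ q F e e∉F) (to (isTree⇔ q) t)) st) (sym (*-zeroʳ (two F)))
        cases (inj₂ s≁t) rewrite R-no s≁t = trans
          (⟦⟧-⇔ (λ t → from (isTwoForest⇔ q) (proj₁ (to (Tree-insert⇔ q F e e∉F) (to (isTree⇔ q) t))))
                (λ t → from (isTree⇔ q) (from (Tree-insert⇔ q F e e∉F) (to (isTwoForest⇔ q) t , s≁t))))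
          (sym (*-identityʳ (two F)))

    -- The N_e of the overview. As `e` belongs to F, testing one of its ends against `q` tests both.
    floating : Fin m → ℤ
    floating e = ∑ 𝓢 (λ F → ⟦ lookup F e ⟧ * (two F * (1ℤ - R F (src e) q)))

    -- Deletion of an edge

    module _ (e : Fin m) where
      private
        x y : Fin n
        x = src e
        y = tgt e

        avoids : EdgeSet G → ℤ
        avoids F = ⟦ not (lookup F e) ⟧

        α : Fin m → ℤ
        α f = ⟦ not ⌊ e ≟ f ⌋ ⟧

        avoids-insert : ∀ F f → ¬ T (lookup F f) → avoids (F [ f ]≔ true) ≡ α f * avoids F
        avoids-insert F f f∉F with e ≟ f
        ... | yes refl rewrite lookup∘update e F true = refl
        ... | no  e≢f  rewrite lookup∘update′ e≢f F true = sym (*-identityˡ (avoids F))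

        K-avoids : κ[ avoids ] ≡ K - separating x y
        K-avoids = begin
          κ[ avoids ]
            ≡⟨ ∑-cong 𝓢 (λ F → trans (cong (_* tree F) (⟦⟧-not (lookup F e))) (distrib ⟦ lookup F e ⟧ (tree F))) ⟩
          ∑ 𝓢 (λ F → 1ℤ * tree F - ⟦ lookup F e ⟧ * tree F)
            ≡⟨ ∑-- 𝓢 (λ F → 1ℤ * tree F) (λ F → ⟦ lookup F e ⟧ * tree F) ⟩
          K - ∑ 𝓢 (λ F → ⟦ lookup F e ⟧ * tree F)
            ≡⟨ cong (K -_) (trees-through e) ⟩
          K - separating x y ∎
          where
          distrib : ∀ a t → (1ℤ - a) * t ≡ 1ℤ * t - a * t
          distrib = solve-∀

        -- A forest through `e` has both ends of `e` in one component, so the hypothesis holds for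
        -- `z = x` and for `z = y`: discarding these forests lowers both values by the same
        -- `floating e`.
        P-avoids : ∀ z → (∀ F → T (lookup F e) → w F x z ≡ 1ℤ - R F x q) → P avoids x z ≡ g x z - floating e
        P-avoids z h = begin
          P avoids x z
            ≡⟨ ∑-cong 𝓢 pointwise ⟩
          ∑ 𝓢 (λ F → 1ℤ * (two F * w F x z) - ⟦ lookup F e ⟧ * (two F * (1ℤ - R F x q)))
            ≡⟨ ∑-- 𝓢 (λ F → 1ℤ * (two F * w F x z)) (λ F → ⟦ lookup F e ⟧ * (two F * (1ℤ - R F x q))) ⟩
          g x z - floating e ∎
          where
          distrib : ∀ a t → (1ℤ - a) * t ≡ 1ℤ * t - a * t
          distrib = solve-∀
          pointwise : ∀ F → avoids F * (two F * w F x z) ≡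
                            1ℤ * (two F * w F x z) - ⟦ lookup F e ⟧ * (two F * (1ℤ - R F x q))
          pointwise F = begin
            avoids F * (two F * w F x z)
              ≡⟨ cong (_* (two F * w F x z)) (⟦⟧-not (lookup F e)) ⟩
            (1ℤ - ⟦ lookup F e ⟧) * (two F * w F x z)
              ≡⟨ distrib ⟦ lookup F e ⟧ (two F * w F x z) ⟩
            1ℤ * (two F * w F x z) - ⟦ lookup F e ⟧ * (two F * w F x z)
              ≡⟨ cong (λ z′ → 1ℤ * (two F * w F x z) - z′) (⟦⟧*-cong (lookup F e) λ e∈F → cong (two F *_) (h F e∈F)) ⟩
            1ℤ * (two F * w F x z) - ⟦ lookup F e ⟧ * (two F * (1ℤ - R F x q)) ∎

        P-avoids-x : P avoids x x ≡ g x x - floating e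
        P-avoids-x = P-avoids x λ F _ → w-self F x

        P-avoids-y : P avoids x y ≡ g x y - floating e
        P-avoids-y = P-avoids y λ F e∈F →
          trans (cong (_* (1ℤ - R F x q)) (R-yes (edge {F} {e} e∈F))) (*-identityˡ (1ℤ - R F x q))

        -- Computing the pairing of g x with its analogue for G - e in both ways.
        reciprocity : K * (P avoids x x - P avoids x q) ≡
                      κ[ avoids ] * (g x x - g x q) + d (g x) e * d (P avoids x) e
        reciprocity = begin
          K * (P avoids x x - P avoids x q)
            ≡⟨ sym (energy-g (P avoids x) x) ⟩
          ∑ E (λ f → d (P avoids x) f * d (g x) f)
            -- The edges other than `e` make up the pairing over G - e, which `energy` evaluates
            -- with weight `avoids`; the edge `e` leaves one extra product.
            ≡⟨ ∑-cong E (λ f → split ⌊ e ≟ f ⌋ (d (P avoids x) f) (d (g x) f)) ⟩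
          ∑ E (λ f → α f * (d (g x) f * d (P avoids x) f) + δ e f * (d (g x) f * d (P avoids x) f))
            ≡⟨ ∑-+ E (λ f → α f * (d (g x) f * d (P avoids x) f)) (λ f → δ e f * (d (g x) f * d (P avoids x) f)) ⟩
          ∑ E (λ f → α f * (d (g x) f * d (P avoids x) f)) + ∑ E (λ f → δ e f * (d (g x) f * d (P avoids x) f))
            ≡⟨ cong₂ _+_ (energy avoids α avoids-insert (g x) x) (∑-δ e (λ f → d (g x) f * d (P avoids x) f)) ⟩
          κ[ avoids ] * (g x x - g x q) + d (g x) e * d (P avoids x) e ∎
          where
          complement : ∀ s a b → a * b ≡ (1ℤ - s) * (b * a) + s * (b * a)
          complement = solve-∀
          split : ∀ s a b → a * b ≡ ⟦ not s ⟧ * (b * a) + ⟦ s ⟧ * (b * a)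
          split s a b = trans (complement ⟦ s ⟧ a b) (cong (λ z → z * (b * a) + ⟦ s ⟧ * (b * a)) (sym (⟦⟧-not s)))

      -- In the notation of the overview, `reciprocity` reads κ(A - N) = (κ - (A + B - 2C))A + (A -
      -- C)², as N cancels from the last difference; expanding gives the claim. Nothing is divided
      -- by the number of trees avoiding `e`, so bridges are covered too.
      floating-minor : K * floating e ≡ g x x * g y y - g x y * g x y
      floating-minor = conclude K (floating e) (g x x) (g y y) (g x y) (begin
        K * (g x x - floating e - 0ℤ)
          ≡⟨ cong₂ (λ a b → K * (a - b)) (sym P-avoids-x) (sym (P-root avoids x)) ⟩
        K * (P avoids x x - P avoids x q)
          ≡⟨ reciprocity ⟩
        κ[ avoids ] * (g x x - g x q) + d (g x) e * (P avoids x x - P avoids x y)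
          ≡⟨ cong₂ (λ a b → κ[ avoids ] * (g x x - g x q) + d (g x) e * (a - b)) P-avoids-x P-avoids-y ⟩
        κ[ avoids ] * (g x x - g x q) + d (g x) e * (g x x - floating e - (g x y - floating e))
          ≡⟨ cong₂ (λ k r → k * (g x x - r) + d (g x) e * (g x x - floating e - (g x y - floating e)))
                   (trans K-avoids (cong (K -_) (separating-g x y))) (P-root 𝟙 x) ⟩
        (K - (g x x + g y y - (g x y + g x y))) * (g x x - 0ℤ)
          + (g x x - g x y) * (g x x - floating e - (g x y - floating e)) ∎)
        where
        conclude : ∀ K N A B C →
          K * (A - N - 0ℤ) ≡ (K - (A + B - (C + C))) * (A - 0ℤ) + (A - C) * (A - N - (C - N)) →
          K * N ≡ A * B - C * C
        conclude K N A B C h = trans (lhs K N A) (trans (cong (K * A -_) h) (rhs K N A B C))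
          where
          lhs : ∀ K N A → K * N ≡ K * A - K * (A - N - 0ℤ)
          lhs = solve-∀
          rhs : ∀ K N A B C → K * A - ((K - (A + B - (C + C))) * (A - 0ℤ) + (A - C) * (A - N - (C - N))) ≡ A * B - C * C
          rhs = solve-∀

    -- Summation by parts: after exchanging the sums, the indicators pick the two ends of each edge
    -- out of the sum over vertices.
    ∑-incidence : ∀ (H : Fin n → Fin m → ℤ) →
                  ∑ V (λ v → ∑ E (λ f → d (λ z → δ z v) f * H v f)) ≡ ∑ E (λ f → H (src f) f - H (tgt f) f)
    ∑-incidence H = trans (∑-swap V E (λ v f → d (λ z → δ z v) f * H v f)) (∑-cong E λ f → begin
      ∑ V (λ v → (δ (src f) v - δ (tgt f) v) * H v f)
        ≡⟨ ∑-cong V (λ v → distrib (δ (src f) v) (δ (tgt f) v) (H v f)) ⟩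
      ∑ V (λ v → δ (src f) v * H v f - δ (tgt f) v * H v f)
        ≡⟨ ∑-- V (λ v → δ (src f) v * H v f) (λ v → δ (tgt f) v * H v f) ⟩
      ∑ V (λ v → δ (src f) v * H v f) - ∑ V (λ v → δ (tgt f) v * H v f)
        ≡⟨ cong₂ _-_ (∑-δ (src f) (λ v → H v f)) (∑-δ (tgt f) (λ v → H v f)) ⟩
      H (src f) f - H (tgt f) f ∎)
      where
      distrib : ∀ a b c → (a - b) * c ≡ a * c - b * c
      distrib = solve-∀

    -- Orient the edges of the component of b towards b and charge each one to its tail.
    component-euler : ∀ {F} b → Forest F → ∑ V (λ v → R F v b) - ∑ E (λ f → ⟦ lookup F f ⟧ * R F (src f) b) ≡ 1ℤ
    component-euler {F} b forest = solveFor (∑ V (λ v → R F v b)) _ (begin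
      ∑ E (λ f → ⟦ lookup F f ⟧ * R F (src f) b)
        ≡⟨ ∑-cong E (λ f → sym (tail f)) ⟩
      ∑ E (λ f → H (src f) f - H (tgt f) f)
        ≡⟨ sym (∑-incidence H) ⟩
      ∑ V (λ v → ∑ E (λ f → d (λ z → δ z v) f * H v f))
        ≡⟨ ∑-cong V byVertex ⟩
      ∑ V (λ v → R F v b - δ b v * R F v b)
        ≡⟨ ∑-- V (λ v → R F v b) (λ v → δ b v * R F v b) ⟩
      ∑ V (λ v → R F v b) - ∑ V (λ v → δ b v * R F v b)
        ≡⟨ cong (∑ V (λ v → R F v b) -_) (trans (∑-δ b (λ v → R F v b)) (R-yes {F} {b} ε)) ⟩
      ∑ V (λ v → R F v b) - 1ℤ ∎)
      where
      solveFor : ∀ s t → t ≡ s - 1ℤ → s - t ≡ 1ℤ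
      solveFor s t h = trans (cong (s -_) h) (cancel s)
        where
        cancel : ∀ s → s - (s - 1ℤ) ≡ 1ℤ
        cancel = solve-∀

      c : Fin m → Fin n → ℤ
      c f = cross (F [ f ]≔ false) f b

      -- For `v` in the component of `b`, the signed crossing of `f` by the path from `v` to `b`;
      -- both `tail` and `byVertex` evaluate its incidence sum, by edges and by vertices.
      H : Fin n → Fin m → ℤ
      H v f = R F v b * (⟦ lookup F f ⟧ * c f v)

      tail : ∀ f → H (src f) f - H (tgt f) f ≡ ⟦ lookup F f ⟧ * R F (src f) b
      tail f with T? (lookup F f)
      ... | no f∉F rewrite ⟦⟧-no f∉F = zeros (R F (src f) b) (R F (tgt f) b) (c f (src f)) (c f (tgt f))
        where
        zeros : ∀ a b c d → a * (0ℤ * c) - b * (0ℤ * d) ≡ 0ℤ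
        zeros = solve-∀
      ... | yes f∈F rewrite ⟦⟧-yes f∈F | sym (R-congˡ b (edge {F} {f} f∈F)) = begin
        R F (src f) b * (1ℤ * c f (src f)) - R F (src f) b * (1ℤ * c f (tgt f))
          ≡⟨ factor (R F (src f) b) (c f (src f)) (c f (tgt f)) ⟩
        R F (src f) b * d (c f) f
          ≡⟨ ⟦⟧*-cong (reach G F (src f) b) (λ t → d-cross-self f b forest f∈F (to reach⇔∼ t)) ⟩
        R F (src f) b * 1ℤ
          ≡⟨ commute (R F (src f) b) ⟩
        1ℤ * R F (src f) b ∎
        where
        factor : ∀ r a b → r * (1ℤ * a) - r * (1ℤ * b) ≡ r * (a - b)
        factor = solve-∀
        commute : ∀ r → r * 1ℤ ≡ 1ℤ * r
        commute = solve-∀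

      -- Along the path from `v` to `b` the indicator of `v` drops from 1 to 0 exactly once, unless
      -- `v` is `b`: every vertex of the component but `b` has one outgoing edge.
      byVertex : ∀ v → ∑ E (λ f → d (λ z → δ z v) f * H v f) ≡ R F v b - δ b v * R F v b
      byVertex v = begin
        ∑ E (λ f → d δᵥ f * (R F v b * (⟦ lookup F f ⟧ * c f v)))
          ≡⟨ ∑-cong E (λ f → rearrange (d δᵥ f) (R F v b) ⟦ lookup F f ⟧ (c f v)) ⟩
        ∑ E (λ f → R F v b * (⟦ lookup F f ⟧ * (d δᵥ f * c f v)))
          ≡⟨ ∑-*ˡ E (R F v b) (λ f → ⟦ lookup F f ⟧ * (d δᵥ f * c f v)) ⟩
        R F v b * flow F δᵥ b v
          ≡⟨ ⟦⟧*-cong (reach G F v b) (λ t → flow-telescopes δᵥ forest (to reach⇔∼ t)) ⟩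
        R F v b * (δ v v - δ b v)
          ≡⟨ cong (λ z → R F v b * (z - δ b v)) (δ-refl v) ⟩
        R F v b * (1ℤ - δ b v)
          ≡⟨ distrib (R F v b) (δ b v) ⟩
        R F v b - δ b v * R F v b ∎
        where
        δᵥ : Fin n → ℤ
        δᵥ z = δ z v
        rearrange : ∀ a b c d → a * (b * (c * d)) ≡ b * (c * (a * d))
        rearrange = solve-∀
        distrib : ∀ r s → r * (1ℤ - s) ≡ r - s * r
        distrib = solve-∀

    -- Two-component forests as an Euler characteristic, and the trace

    K₂ : ℤ
    K₂ = ∑ 𝓢 two

    K₂-floating : K₂ ≡ ∑ V (λ v → g v v) - ∑ E floating
    K₂-floating = begin
      ∑ 𝓢 two
        ≡⟨ ∑-cong 𝓢 pointwise ⟩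
      ∑ 𝓢 (λ F → ∑ V (λ v → pᵥ v F) - ∑ E (λ f → pₑ f F))
        ≡⟨ ∑-- 𝓢 (λ F → ∑ V (λ v → pᵥ v F)) (λ F → ∑ E (λ f → pₑ f F)) ⟩
      ∑ 𝓢 (λ F → ∑ V (λ v → pᵥ v F)) - ∑ 𝓢 (λ F → ∑ E (λ f → pₑ f F))
        ≡⟨ cong₂ _-_ (∑-swap 𝓢 V (λ F v → pᵥ v F)) (∑-swap 𝓢 E (λ F f → pₑ f F)) ⟩
      ∑ V (λ v → g v v) - ∑ E floating ∎
      where
      pᵥ : Fin n → EdgeSet G → ℤ
      pᵥ v F = 1ℤ * (two F * w F v v)
      pₑ : Fin m → EdgeSet G → ℤ
      pₑ f F = ⟦ lookup F f ⟧ * (two F * (1ℤ - R F (src f) q))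

      -- `b` names the component away from `q`, which turns `1ℤ - R F v q` into the form
      -- `component-euler` speaks of.
      other : ∀ {F} → TwoForest q F → ∃ λ b → ∀ v → R F v b ≡ 1ℤ - R F v q
      other {F} (_ , (b , b≁q) , join) = b , λ v → [ near , far ]′ (∼? F v q)
        where
        near : ∀ {v} → F ⊢ v ∼ q → R F v b ≡ 1ℤ - R F v q
        near vq rewrite R-yes vq = R-no λ vb → b≁q (∼-sym vb ◅◅ vq)
        far : ∀ {v} → ¬ F ⊢ v ∼ q → R F v b ≡ 1ℤ - R F v q
        far {v} v≁q rewrite R-no v≁q = R-yes (join v b v≁q b≁q)

      one : ∀ F → TwoForest q F → 1ℤ ≡ ∑ V (λ v → w F v v) - ∑ E (λ f → ⟦ lookup F f ⟧ * (1ℤ - R F (src f) q))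
      one F tf with other tf
      ... | b , R-b = begin
        1ℤ
          ≡⟨ sym (component-euler b (proj₁ tf)) ⟩
        ∑ V (λ v → R F v b) - ∑ E (λ f → ⟦ lookup F f ⟧ * R F (src f) b)
          ≡⟨ cong₂ _-_ (∑-cong V (λ v → trans (R-b v) (sym (w-self F v))))
                       (∑-cong E (λ f → cong (⟦ lookup F f ⟧ *_) (R-b (src f)))) ⟩
        ∑ V (λ v → w F v v) - ∑ E (λ f → ⟦ lookup F f ⟧ * (1ℤ - R F (src f) q)) ∎

      pointwise : ∀ F → two F ≡ ∑ V (λ v → pᵥ v F) - ∑ E (λ f → pₑ f F)
      pointwise F = begin
        two F
          ≡⟨ sym (*-identityʳ (two F)) ⟩
        two F * 1ℤ
          ≡⟨ ⟦⟧*-cong (isTwoForest F) (one F ∘ to (isTwoForest⇔ q)) ⟩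
        two F * (∑ V (λ v → w F v v) - ∑ E (λ f → ⟦ lookup F f ⟧ * (1ℤ - R F (src f) q)))
          ≡⟨ distrib (two F) (∑ V (λ v → w F v v)) (∑ E (λ f → ⟦ lookup F f ⟧ * (1ℤ - R F (src f) q))) ⟩
        two F * ∑ V (λ v → w F v v) - two F * ∑ E (λ f → ⟦ lookup F f ⟧ * (1ℤ - R F (src f) q))
          ≡⟨ cong₂ _-_
               (trans (sym (∑-*ˡ V (two F) (λ v → w F v v))) (∑-cong V (λ v → sym (*-identityˡ (two F * w F v v)))))
               (trans (sym (∑-*ˡ E (two F) (λ f → ⟦ lookup F f ⟧ * (1ℤ - R F (src f) q))))
                      (∑-cong E (λ f → commute (two F) ⟦ lookup F f ⟧ (1ℤ - R F (src f) q)))) ⟩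
        ∑ V (λ v → pᵥ v F) - ∑ E (λ f → pₑ f F) ∎
        where
        distrib : ∀ a b c → a * (b - c) ≡ a * b - a * c
        distrib = solve-∀
        commute : ∀ a b c → a * (b * c) ≡ b * (a * c)
        commute = solve-∀

    -- The weak form for the indicator of `v` is multiplied by `g v v` and summed over `v`;
    -- `∑-incidence` then collects the terms at the ends of each edge.
    trace : K * ∑ V (λ v → g v v) ≡ ∑ E (λ f → g (src f) (src f) * d (g (src f)) f - g (tgt f) (tgt f) * d (g (tgt f)) f)
    trace = begin
      K * ∑ V (λ v → g v v)
        ≡⟨ sym (∑-*ˡ V K (λ v → g v v)) ⟩
      ∑ V (λ v → K * g v v)
        ≡⟨ ∑-cong V byVertex ⟩
      ∑ V (λ v → ∑ E (λ f → d (λ z → δ z v) f * (g v v * d (g v) f)))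
        ≡⟨ ∑-incidence (λ v f → g v v * d (g v) f) ⟩
      ∑ E (λ f → g (src f) (src f) * d (g (src f)) f - g (tgt f) (tgt f) * d (g (tgt f)) f) ∎
      where
      -- The difference of indicators is 1 except at `v = q`, where it is 0 but `g q q` vanishes as
      -- well.
      grounded : ∀ v → K * g v v ≡ g v v * (K * (δ v v - δ q v))
      grounded v with q ≟ v
      ... | yes refl rewrite P-root 𝟙 q = *-zeroʳ K
      ... | no  q≢v  rewrite δ-refl v = simplify K (g v v)
        where
        simplify : ∀ k a → k * a ≡ a * (k * (1ℤ - 0ℤ))
        simplify = solve-∀
      byVertex : ∀ v → K * g v v ≡ ∑ E (λ f → d (λ z → δ z v) f * (g v v * d (g v) f))
      byVertex v = begin
        K * g v v
          ≡⟨ grounded v ⟩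
        g v v * (K * (δ v v - δ q v))
          ≡⟨ cong (g v v *_) (sym (energy-g (λ z → δ z v) v)) ⟩
        g v v * ∑ E (λ f → d (λ z → δ z v) f * d (g v) f)
          ≡⟨ sym (∑-*ˡ E (g v v) (λ f → d (λ z → δ z v) f * d (g v) f)) ⟩
        ∑ E (λ f → g v v * (d (λ z → δ z v) f * d (g v) f))
          ≡⟨ ∑-cong E (λ f → commute (g v v) (d (λ z → δ z v) f) (d (g v) f)) ⟩
        ∑ E (λ f → d (λ z → δ z v) f * (g v v * d (g v) f)) ∎
        where
        commute : ∀ a b c → a * (b * c) ≡ b * (a * c)
        commute = solve-∀

    -- The identity in integers

    sq : ℤ → ℤ
    sq z = z * z

    -- The theorem multiplied by 4κ², which turns every resistance into a count.
    two-forests : ℤ.+ 4 * (K * K₂) ≡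
      ℤ.+ 3 * ∑ E (λ e → sq (separating (src e) q - separating (tgt e) q)) + ∑ E (λ e → sq (separating (src e) (tgt e)))
    two-forests = begin
      ℤ.+ 4 * (K * K₂)
        ≡⟨ cong (λ z → ℤ.+ 4 * (K * z)) K₂-floating ⟩
      ℤ.+ 4 * (K * (∑ V (λ v → g v v) - ∑ E floating))
        ≡⟨ cong (ℤ.+ 4 *_) (trans (distrib K (∑ V (λ v → g v v)) (∑ E floating))
             (cong₂ _-_ trace (trans (sym (∑-*ˡ E K floating)) (∑-cong E floating-minor)))) ⟩
      ℤ.+ 4 * (∑ E tr - ∑ E minor)
        ≡⟨ cong (ℤ.+ 4 *_) (sym (∑-- E tr minor)) ⟩
      ℤ.+ 4 * ∑ E (λ e → tr e - minor e)
        ≡⟨ sym (∑-*ˡ E (ℤ.+ 4) (λ e → tr e - minor e)) ⟩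
      ∑ E (λ e → ℤ.+ 4 * (tr e - minor e))
        ≡⟨ ∑-cong E byEdge ⟩
      ∑ E (λ e → ℤ.+ 3 * diff e + res e)
        ≡⟨ ∑-+ E (λ e → ℤ.+ 3 * diff e) res ⟩
      ∑ E (λ e → ℤ.+ 3 * diff e) + ∑ E res
        ≡⟨ cong (_+ ∑ E res) (∑-*ˡ E (ℤ.+ 3) diff) ⟩
      ℤ.+ 3 * ∑ E diff + ∑ E res ∎
      where
      tr minor diff res : Fin m → ℤ
      tr e = g (src e) (src e) * d (g (src e)) e - g (tgt e) (tgt e) * d (g (tgt e)) e
      minor e = g (src e) (src e) * g (tgt e) (tgt e) - g (src e) (tgt e) * g (src e) (tgt e)
      diff e = sq (separating (src e) q - separating (tgt e) q)
      res e = sq (separating (src e) (tgt e))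
      distrib : ∀ a b c → a * (b - c) ≡ a * b - a * c
      distrib = solve-∀
      -- The bracket on the left expands to A² + B² + C² - AB - AC - BC.
      identity : ∀ A B C → ℤ.+ 4 * (A * (A - C) - B * (C - B) - (A * B - C * C)) ≡
                           ℤ.+ 3 * ((A - B) * (A - B)) + (A + B - (C + C)) * (A + B - (C + C))
      identity = solve-∀
      byEdge : ∀ e → ℤ.+ 4 * (tr e - minor e) ≡ ℤ.+ 3 * diff e + res e
      byEdge e = begin
        ℤ.+ 4 * (tr e - minor e)
          ≡⟨ cong (λ z → ℤ.+ 4 * (A * (A - C) - B * (z - B) - (A * B - C * C))) (P-sym 𝟙 (tgt e) (src e)) ⟩
        ℤ.+ 4 * (A * (A - C) - B * (C - B) - (A * B - C * C))
          ≡⟨ identity A B C ⟩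
        ℤ.+ 3 * sq (A - B) + sq (A + B - (C + C))
          ≡⟨ sym (cong₂ (λ y z → ℤ.+ 3 * y + z)
                   (cong₂ (λ y z → sq (y - z)) (separating-root (src e)) (separating-root (tgt e)))
                   (cong sq (separating-g (src e) (tgt e)))) ⟩
        ℤ.+ 3 * diff e + res e ∎
        where
        A = g (src e) (src e)
        B = g (tgt e) (tgt e)
        C = g (src e) (tgt e)

    -- Agreement with the counts of the definitions

    κ≡K : ℤ.+ κ G ≡ K
    κ≡K = trans (length-filterᵇ isTree 𝓢) (∑-cong 𝓢 λ F → sym (*-identityˡ (tree F)))

    κ₂≡K₂ : ℤ.+ κ₂ G ≡ K₂
    κ₂≡K₂ = length-filterᵇ isTwoForest 𝓢

    κ₂sep≡separating : ∀ x y → ℤ.+ κ₂sep G x y ≡ separating x y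
    κ₂sep≡separating x y = trans (length-filterᵇ _ 𝓢) (∑-cong 𝓢 λ F → begin
      ⟦ isForest G F ∧ (numComponents G F ≡ᵇ 2) ∧ not (reach G F x y) ⟧
        ≡⟨ cong ⟦_⟧ (sym (∧-assoc (isForest G F) (numComponents G F ≡ᵇ 2) (not (reach G F x y)))) ⟩
      ⟦ isTwoForest F ∧ not (reach G F x y) ⟧
        ≡⟨ ⟦⟧-∧ (isTwoForest F) (not (reach G F x y)) ⟩
      two F * ⟦ not (reach G F x y) ⟧
        ≡⟨ cong (two F *_) (⟦⟧-not (reach G F x y)) ⟩
      two F * (1ℤ - R F x y) ∎)

    κκ₂ : ℤ.+ 4 * (ℤ.+ κ G * ℤ.+ κ₂ G) ≡
      ℤ.+ 3 * ∑ E (λ e → sq (ℤ.+ κ₂sep G (src e) q - ℤ.+ κ₂sep G (tgt e) q))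
      + ∑ E (λ e → sq (ℤ.+ κ₂sep G (src e) (tgt e)))
    κκ₂ = begin
      ℤ.+ 4 * (ℤ.+ κ G * ℤ.+ κ₂ G)
        ≡⟨ cong₂ (λ a b → ℤ.+ 4 * (a * b)) κ≡K κ₂≡K₂ ⟩
      ℤ.+ 4 * (K * K₂)
        ≡⟨ two-forests ⟩
      ℤ.+ 3 * ∑ E (λ e → sq (separating (src e) q - separating (tgt e) q)) + ∑ E (λ e → sq (separating (src e) (tgt e)))
        ≡⟨ sym (cong₂ (λ a b → ℤ.+ 3 * a + b)
             (∑-cong E λ e → cong₂ (λ a b → sq (a - b)) (κ₂sep≡separating (src e) q) (κ₂sep≡separating (tgt e) q))
             (∑-cong E λ e → cong sq (κ₂sep≡separating (src e) (tgt e)))) ⟩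
      ℤ.+ 3 * ∑ E (λ e → sq (ℤ.+ κ₂sep G (src e) q - ℤ.+ κ₂sep G (tgt e) q))
      + ∑ E (λ e → sq (ℤ.+ κ₂sep G (src e) (tgt e))) ∎

-- Passage to rational numbers

open IntegerCounts using (∑; module Rooted)
open import Data.Integer as ℤ using (ℤ; +_)
import Data.Integer.Properties as ℤ
open import Data.Rational using (ℚ; 0ℚ; 1ℚ; _/_; _+_; _*_; _-_; fromℚᵘ)
open import Data.Rational.Properties using (toℚᵘ-injective; toℚᵘ-homo-+; toℚᵘ-homo-*; toℚᵘ-fromℚᵘ; fromℚᵘ-cong; *-zeroˡ; *-zeroʳ)
open import Data.Rational.Solver using (module +-*-Solver)
open import Data.Rational.Unnormalised as ℚᵘ using (mkℚᵘ; *≡*)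
import Data.Rational.Unnormalised.Properties as ℚᵘ
open +-*-Solver using (solve; _:=_; _:*_; _:+_; _:-_; con)

-- Compared among unnormalised rationals, where reduction to lowest terms is invisible up to
-- equivalence.
fromℚᵘ-homo-+ : ∀ p p′ → fromℚᵘ (p ℚᵘ.+ p′) ≡ fromℚᵘ p + fromℚᵘ p′
fromℚᵘ-homo-+ p p′ = toℚᵘ-injective (ℚᵘ.≃-trans (toℚᵘ-fromℚᵘ (p ℚᵘ.+ p′)) (ℚᵘ.≃-sym
  (ℚᵘ.≃-trans (toℚᵘ-homo-+ (fromℚᵘ p) (fromℚᵘ p′)) (ℚᵘ.+-cong (toℚᵘ-fromℚᵘ p) (toℚᵘ-fromℚᵘ p′)))))

fromℚᵘ-homo-* : ∀ p p′ → fromℚᵘ (p ℚᵘ.* p′) ≡ fromℚᵘ p * fromℚᵘ p′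
fromℚᵘ-homo-* p p′ = toℚᵘ-injective (ℚᵘ.≃-trans (toℚᵘ-fromℚᵘ (p ℚᵘ.* p′)) (ℚᵘ.≃-sym
  (ℚᵘ.≃-trans (toℚᵘ-homo-* (fromℚᵘ p) (fromℚᵘ p′)) (ℚᵘ.*-cong (toℚᵘ-fromℚᵘ p) (toℚᵘ-fromℚᵘ p′)))))

fromℤ : ℤ → ℚ
fromℤ z = z / 1

fromℤ-homo-+ : ∀ a b → fromℤ (a ℤ.+ b) ≡ fromℤ a + fromℤ b
fromℤ-homo-+ a b = trans
  -- Unnormalised addition multiplies each numerator by the other denominator, here 1.
  (cong fromℤ (sym (cong₂ ℤ._+_ (ℤ.*-identityʳ a) (ℤ.*-identityʳ b))))
  (fromℚᵘ-homo-+ (mkℚᵘ a 0) (mkℚᵘ b 0))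

fromℤ-homo-* : ∀ a b → fromℤ (a ℤ.* b) ≡ fromℤ a * fromℤ b
fromℤ-homo-* a b = fromℚᵘ-homo-* (mkℚᵘ a 0) (mkℚᵘ b 0)

fromℤ-homo-- : ∀ a b → fromℤ (a ℤ.- b) ≡ fromℤ a - fromℤ b
fromℤ-homo-- a b = begin
  fromℤ (a ℤ.- b)                       ≡⟨ cancel (fromℤ (a ℤ.- b)) (fromℤ b) ⟩
  fromℤ (a ℤ.- b) + fromℤ b - fromℤ b ≡⟨ cong (_- fromℤ b) (sym (fromℤ-homo-+ (a ℤ.- b) b)) ⟩
  fromℤ (a ℤ.- b ℤ.+ b) - fromℤ b      ≡⟨ cong (λ z → fromℤ z - fromℤ b) a-b+b ⟩
  fromℤ a - fromℤ b                     ∎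
  where
  cancel : ∀ x y → x ≡ x + y - y
  cancel = solve 2 (λ x y → x := x :+ y :- y) refl
  a-b+b : a ℤ.- b ℤ.+ b ≡ a
  a-b+b = trans (ℤ.+-assoc a (ℤ.- b) b) (trans (cong (λ z → a ℤ.+ z) (ℤ.+-inverseˡ b)) (ℤ.+-identityʳ a))

-- The junk value inv 0 = 0 makes fromℤ*inv² hold at 0 as well.
inv : ℕ → ℚ
inv k = divℚ 1 k

divℚ≡* : ∀ a k → divℚ a k ≡ fromℤ (+ a) * inv k
-- Both `divℚ a 0` and `inv 0` are the default value 0.
divℚ≡* a zero    = sym (*-zeroʳ (fromℤ (+ a)))
divℚ≡* a (suc k) = trans (fromℚᵘ-cong {mkℚᵘ (+ a) k} {mkℚᵘ (+ a) 0 ℚᵘ.* mkℚᵘ (+ 1) k} (*≡* eq))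
                         (fromℚᵘ-homo-* (mkℚᵘ (+ a) 0) (mkℚᵘ (+ 1) k))
  where
  eq : + a ℤ.* (+ 1 ℤ.* + suc k) ≡ + a ℤ.* + 1 ℤ.* + suc k
  eq = sym (ℤ.*-assoc (+ a) (+ 1) (+ suc k))

fromℤ*inv² : ∀ k → fromℤ (+ k) * inv k * inv k ≡ inv k
fromℤ*inv² zero    = *-zeroʳ (fromℤ (+ 0) * 0ℚ)
fromℤ*inv² (suc k) = trans (cong (_* inv (suc k)) (trans (sym (divℚ≡* (suc k) (suc k))) unit)) (one (inv (suc k)))
  where
  unit : divℚ (suc k) (suc k) ≡ 1ℚ
  unit = fromℚᵘ-cong {mkℚᵘ (+ suc k) k} {mkℚᵘ (+ 1) 0} (*≡* (ℤ.*-comm (+ suc k) (+ 1)))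
  one : ∀ x → 1ℚ * x ≡ x
  one = solve 1 (λ x → con 1ℚ :* x := x) refl

-- Takes the common factor 1/κ² out of the sums over edges, leaving integer sums to which `κκ₂`
-- applies.
foldr-scale : ∀ {A : Set} (xs : List A) {f : A → ℚ} (z : A → ℤ) c → (∀ a → f a ≡ fromℤ (z a) * c) →
              foldr (λ a s → f a + s) 0ℚ xs ≡ fromℤ (∑ xs z) * c
foldr-scale []       z c h = sym (*-zeroˡ c)
foldr-scale (x ∷ xs) {f} z c h = begin
  f x + foldr (λ a s → f a + s) 0ℚ xs
    ≡⟨ cong₂ _+_ (h x) (foldr-scale xs z c h) ⟩
  fromℤ (z x) * c + fromℤ (∑ xs z) * c
    ≡⟨ distrib (fromℤ (z x)) (fromℤ (∑ xs z)) c ⟩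
  (fromℤ (z x) + fromℤ (∑ xs z)) * c
    ≡⟨ cong (_* c) (sym (fromℤ-homo-+ (z x) (∑ xs z))) ⟩
  fromℤ (∑ (x ∷ xs) z) * c ∎
  where
  distrib : ∀ a b c → a * c + b * c ≡ (a + b) * c
  distrib = solve 3 (λ a b c → a :* c :+ b :* c := (a :+ b) :* c) refl

theorem5p7 : (G : Graph) → Connected G → (q : Fin (Graph.n G)) →
    divℚ (κ₂ G) (κ G)
    ≡ ((+ 3 / 4) * sumEdges G (λ e → (r G (Graph.src G e) q - r G (Graph.tgt G e) q) * (r G (Graph.src G e) q - r G (Graph.tgt G e) q)))
    + ((+ 1 / 4) * sumEdges G (λ e → r G (Graph.src G e) (Graph.tgt G e) * r G (Graph.src G e) (Graph.tgt G e)))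
theorem5p7 G _ q = sym (begin
  (+ 3 / 4) * sumEdges G (λ e → (r G (src e) q - r G (tgt e) q) * (r G (src e) q - r G (tgt e) q))
    + (+ 1 / 4) * sumEdges G (λ e → r G (src e) (tgt e) * r G (src e) (tgt e))
    ≡⟨ cong₂ (λ a b → (+ 3 / 4) * a + (+ 1 / 4) * b)
         (foldr-scale (allFin m) diff (t * t) diff-scale) (foldr-scale (allFin m) res (t * t) res-scale) ⟩
  (+ 3 / 4) * (fromℤ D * (t * t)) + (+ 1 / 4) * (fromℤ S * (t * t))
    ≡⟨ collect (fromℤ D) (fromℤ S) t ⟩
  (+ 1 / 4) * (t * t) * (fromℤ (+ 3) * fromℤ D + fromℤ S)
    ≡⟨ cong ((+ 1 / 4) * (t * t) *_) (begin
         fromℤ (+ 3) * fromℤ D + fromℤ S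
           ≡⟨ sym (trans (fromℤ-homo-+ (+ 3 ℤ.* D) S) (cong (_+ fromℤ S) (fromℤ-homo-* (+ 3) D))) ⟩
         fromℤ (+ 3 ℤ.* D ℤ.+ S)
           -- `D` and `S` are the edge sums of `κκ₂` with `sq` unfolded.
           ≡⟨ cong fromℤ (sym (Rooted.κκ₂ G q)) ⟩
         fromℤ (+ 4 ℤ.* (+ κ G ℤ.* + κ₂ G))
           ≡⟨ trans (fromℤ-homo-* (+ 4) (+ κ G ℤ.* + κ₂ G)) (cong (fromℤ (+ 4) *_) (fromℤ-homo-* (+ κ G) (+ κ₂ G))) ⟩
         fromℤ (+ 4) * (fromℤ (+ κ G) * fromℤ (+ κ₂ G)) ∎) ⟩
  (+ 1 / 4) * (t * t) * (fromℤ (+ 4) * (fromℤ (+ κ G) * fromℤ (+ κ₂ G)))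
    -- The constants 1/4 and 4 cancel; the product of κ and t² is kept together so that `fromℤ*inv²`
    -- can reduce it to t.
    ≡⟨ cancel (fromℤ (+ κ G)) (fromℤ (+ κ₂ G)) t ⟩
  fromℤ (+ κ₂ G) * (fromℤ (+ κ G) * t * t)
    ≡⟨ cong (fromℤ (+ κ₂ G) *_) (fromℤ*inv² (κ G)) ⟩
  fromℤ (+ κ₂ G) * t
    ≡⟨ sym (divℚ≡* (κ₂ G) (κ G)) ⟩
  divℚ (κ₂ G) (κ G) ∎)
  where
  open Graph G
  t : ℚ
  t = inv (κ G)

  s : Fin n → Fin n → ℤ
  s x y = + κ₂sep G x y

  diff res : Fin m → ℤ
  diff e = (s (src e) q ℤ.- s (tgt e) q) ℤ.* (s (src e) q ℤ.- s (tgt e) q)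
  res  e = s (src e) (tgt e) ℤ.* s (src e) (tgt e)

  D S : ℤ
  D = ∑ (allFin m) diff
  S = ∑ (allFin m) res

  diff-scale : ∀ e → (r G (src e) q - r G (tgt e) q) * (r G (src e) q - r G (tgt e) q) ≡ fromℤ (diff e) * (t * t)
  diff-scale e = begin
    (r G (src e) q - r G (tgt e) q) * (r G (src e) q - r G (tgt e) q)
      ≡⟨ cong₂ (λ a b → (a - b) * (a - b)) (divℚ≡* (κ₂sep G (src e) q) (κ G)) (divℚ≡* (κ₂sep G (tgt e) q) (κ G)) ⟩
    (a * t - b * t) * (a * t - b * t)
      ≡⟨ solve 3 (λ a b t → (a :* t :- b :* t) :* (a :* t :- b :* t) := (a :- b) :* (a :- b) :* (t :* t)) refl a b t ⟩
    (a - b) * (a - b) * (t * t)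
      ≡⟨ cong (_* (t * t)) (sym (trans (fromℤ-homo-* Δ Δ) (cong₂ _*_ a-b a-b))) ⟩
    fromℤ (diff e) * (t * t) ∎
    where
    a = fromℤ (s (src e) q)
    b = fromℤ (s (tgt e) q)
    Δ = s (src e) q ℤ.- s (tgt e) q
    a-b = fromℤ-homo-- (s (src e) q) (s (tgt e) q)

  res-scale : ∀ e → r G (src e) (tgt e) * r G (src e) (tgt e) ≡ fromℤ (res e) * (t * t)
  res-scale e = begin
    r G (src e) (tgt e) * r G (src e) (tgt e)
      ≡⟨ cong (λ a → a * a) (divℚ≡* (κ₂sep G (src e) (tgt e)) (κ G)) ⟩
    (a * t) * (a * t)
      ≡⟨ solve 2 (λ a t → (a :* t) :* (a :* t) := a :* a :* (t :* t)) refl a t ⟩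
    a * a * (t * t)
      ≡⟨ cong (_* (t * t)) (sym (fromℤ-homo-* (s (src e) (tgt e)) (s (src e) (tgt e)))) ⟩
    fromℤ (res e) * (t * t) ∎
    where
    a = fromℤ (s (src e) (tgt e))

  collect : ∀ x y t → (+ 3 / 4) * (x * (t * t)) + (+ 1 / 4) * (y * (t * t)) ≡
                      (+ 1 / 4) * (t * t) * (fromℤ (+ 3) * x + y)
  collect = solve 3 (λ x y t → con (+ 3 / 4) :* (x :* (t :* t)) :+ con (+ 1 / 4) :* (y :* (t :* t)) :=
                               con (+ 1 / 4) :* (t :* t) :* (con (+ 3 / 1) :* x :+ y)) refl

  cancel : ∀ k l t → (+ 1 / 4) * (t * t) * (fromℤ (+ 4) * (k * l)) ≡ l * (k * t * t)
  cancel = solve 3 (λ k l t → con (+ 1 / 4) :* (t :* t) :* (con (+ 4 / 1) :* (k :* l)) := l :* (k :* t :* t)) refl
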